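{- Let $\mathbb{Q}^+=\{r\in\mathbb{Q}\mid r>0\}$ and let $\mathcal{L}=\langle 1,\cdot,{}^{ -1},<,R_2,R_3,\ldots\rangle$. The structure $\langle\mathbb{Q}^+,\mathcal{L}\rangle$ admits quantifier elimination: for every first-order $\mathcal{L}$-formula $\varphi(x_1,\ldots,x_n)$ there is a quantifier-free $\mathcal{L}$-formula $\psi(x_1,\ldots,x_n)$ such that for all $a_1,\ldots,a_n\in\mathbb{Q}^+$, $\varphi(a_1,\ldots,a_n)$ holds in $\langle\mathbb{Q}^+,\mathcal{L}\rangle$ if and only if $\psi(a_1,\ldots,a_n)$ does.
   Context: The symbols of $\mathcal{L}$ are interpreted in $\mathbb{Q}^+$ as follows: $1$ is the number one, $\cdot$ is multiplication, ${}^{ -1}$ is the multiplicative inverse, $<$ is the usual strict order, and for each integer $n\geqslant 2$, $R_n$ is the unary predicate "being the $n$th power of a rational", i.e. for $x \in \mathbb{Q}^+$, $R_n(x)$ holds if and only if there exists $y\in\mathbb{Q}^+$ with $x=y^n$. (For positive rational $x$, being an $n$th power of a rational and of a positive rational are the same.) -}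

module Defs where

import Algebra.Definitions.RawSemiring as RawSemiringDefinitions
open import Data.Fin.Base using (Fin)
open import Data.Nat.Base using (ℕ; suc; NonTrivial)
open import Data.Product.Base using (_×_; ∃-syntax)
open import Data.Rational.Base using (ℚ; 1ℚ; Positive; +-*-rawSemiring)
import Data.Rational.Base as ℚ
import Data.Rational.Properties as ℚ
open import Data.Sum.Base using (_⊎_)
open import Data.Vec.Base using (Vec; _∷_; lookup)
open import Relation.Binary.PropositionalEquality.Core using (_≡_)
open import Relation.Nullary.Negation.Core using (¬_)

open RawSemiringDefinitions +-*-rawSemiring using (_^_)

-- Positivity is proof-irrelevant, so _≡_ on ℚ⁺ is equality of the
-- underlying rationals.
record ℚ⁺ : Set where
  constructor mkℚ⁺
  field
    value         : ℚ
    .{{positive}} : Positive value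

open ℚ⁺ public

infixl 7 _*⁺_
infix  8 _⁻¹⁺
infix  4 _<⁺_

1⁺ : ℚ⁺
1⁺ = mkℚ⁺ 1ℚ

_*⁺_ : ℚ⁺ → ℚ⁺ → ℚ⁺
mkℚ⁺ p *⁺ mkℚ⁺ q = mkℚ⁺ (p ℚ.* q) {{ℚ.pos*pos⇒pos p q}}

_⁻¹⁺ : ℚ⁺ → ℚ⁺
mkℚ⁺ p ⁻¹⁺ = mkℚ⁺ ((ℚ.1/ p) {{ℚ.pos⇒nonZero p}}) {{ℚ.1/pos⇒pos p}}

_<⁺_ : ℚ⁺ → ℚ⁺ → Set
x <⁺ y = value x ℚ.< value y

IsPower : ℕ → ℚ⁺ → Set
IsPower n x = ∃[ y ] value x ≡ value y ^ n

-- Terms and formulas over ⟨1, ·, ⁻¹, <, R₂, R₃, …⟩ (with equality) whose free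
-- variables are among n de Bruijn-indexed variables; a quantifier binds
-- variable zero.
infixl 7 _·_
infix  8 _⁻¹

data Term (n : ℕ) : Set where
  var : Fin n → Term n
  𝟏   : Term n
  _·_ : Term n → Term n → Term n
  _⁻¹ : Term n → Term n

infix  5 _≐_ _≺_
infix  4 ~_
infixr 3 _∧_
infixr 2 _∨_
infixr 1 _⇒_

data Formula (n : ℕ) : Set where
  _≐_ _≺_     : Term n → Term n → Formula n
  R           : (k : ℕ) → .{{NonTrivial k}} → Term n → Formula n
  ~_          : Formula n → Formula n
  _∧_ _∨_ _⇒_ : Formula n → Formula n → Formula n
  all ex      : Formula (suc n) → Formula n

data QuantifierFree {n : ℕ} : Formula n → Set where
  _≐_ : ∀ s t → QuantifierFree (s ≐ t)
  _≺_ : ∀ s t → QuantifierFree (s ≺ t)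
  R   : ∀ k .{{_ : NonTrivial k}} t → QuantifierFree (R k t)
  ~_  : ∀ {φ} → QuantifierFree φ → QuantifierFree (~ φ)
  _∧_ : ∀ {φ ψ} → QuantifierFree φ → QuantifierFree ψ → QuantifierFree (φ ∧ ψ)
  _∨_ : ∀ {φ ψ} → QuantifierFree φ → QuantifierFree ψ → QuantifierFree (φ ∨ ψ)
  _⇒_ : ∀ {φ ψ} → QuantifierFree φ → QuantifierFree ψ → QuantifierFree (φ ⇒ ψ)

⟦_⟧ : ∀ {n} → Term n → Vec ℚ⁺ n → ℚ⁺
⟦ var i ⟧ as = lookup as i
⟦ 𝟏 ⟧     as = 1⁺
⟦ s · t ⟧ as = ⟦ s ⟧ as *⁺ ⟦ t ⟧ as
⟦ t ⁻¹ ⟧  as = ⟦ t ⟧ as ⁻¹⁺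

-- Satisfaction in ⟨ℚ⁺, 1, ·, ⁻¹, <, R₂, R₃, …⟩. The connectives and
-- quantifiers are read constructively. Atomic, hence quantifier-free, formulas
-- are decidable here, so under quantifier elimination every formula is, and
-- the reading agrees with the classical one.
infix 0 _⊨_

_⊨_ : ∀ {n} → Vec ℚ⁺ n → Formula n → Set
as ⊨ s ≐ t = ⟦ s ⟧ as ≡ ⟦ t ⟧ as
as ⊨ s ≺ t = ⟦ s ⟧ as <⁺ ⟦ t ⟧ as
as ⊨ R k t = IsPower k (⟦ t ⟧ as)
as ⊨ ~ φ   = ¬ (as ⊨ φ)
as ⊨ φ ∧ ψ = (as ⊨ φ) × (as ⊨ ψ)
as ⊨ φ ∨ ψ = (as ⊨ φ) ⊎ (as ⊨ ψ)
as ⊨ φ ⇒ ψ = (as ⊨ φ) → (as ⊨ ψ)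
as ⊨ all φ = (a : ℚ⁺) → a ∷ as ⊨ φ
as ⊨ ex φ  = ∃[ a ] (a ∷ as ⊨ φ)

{-# OPTIONS --safe #-}
module Submission where

-- A quantifier-free formula φ(x, a) is brought into disjunctive normal form,
-- and all occurrences of x in a conjunction are raised to a common exponent m;
-- then ∃ x becomes ∃ y over the m-th powers y. An equation y = t is
-- substituted. Otherwise there remain bounds s < y < t and conditions that y
-- lies in, or avoids, cosets of subgroups of k-th powers. By the Chinese
-- remainder theorem, the cosets in which y has to lie intersect in a single
-- coset of the K-th powers, provided that quotients of their representatives
-- are powers of exponent gcd. A coset of the k-th powers to be avoided imposes
-- a condition on the parameters if k ∣ K; if k ∤ K, it is avoided by the K-th
-- power of a prime occurring in none of the parameters. Finally, each coset of
-- N-th powers is dense, so that the order only demands s < t.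

open import Defs
open import Algebra.Bundles using (AbelianGroup)
open import Algebra.Definitions.RawMonoid using () renaming (_×_ to mult)
open import Algebra.Structures using (IsAbelianGroup)
open import Data.Fin.Base using (zero; suc)
open import Data.Fin.Patterns using (0F; 1F; 2F; 3F)
open import Data.Integer.Base using (+[1+_]; +<+)
import Data.Integer.Base as ℤ
import Data.Integer.Properties as ℤ
open import Data.List.Base using (List; []; _∷_; _++_; map)
open import Data.List.Relation.Unary.All using (All; []; _∷_)
import Data.List.Relation.Unary.All as All
import Data.List.Relation.Unary.All.Properties as All
open import Data.List.Relation.Unary.Any using (Any; here; there)
import Data.List.Relation.Unary.Any as Any
import Data.List.Relation.Unary.Any.Properties as Any
open import Data.Nat.Base using (ℕ; zero; suc; NonZero; _≤_; _<_; _+_; _*_)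
import Data.Nat.Base as ℕ
open import Data.Nat.Coprimality
  using (Coprime; coprime-divisor; GCD≡1⇒coprime; 1-coprimeTo) renaming (sym to coprime-sym)
open import Data.Nat.Divisibility
  using (_∣_; _∤_; divides; _∣?_; ∣-trans; ∣1⇒≡1; m∣m*n; n∣m*n; *-cancelˡ-∣; ∣m+n∣m⇒∣n;
         ∣m⇒∣m*n; ∣n⇒∣m*n; *-monoˡ-∣; >⇒∤)
open import Data.Nat.GCD using (GCD; mkGCD; GCD-*; module Bézout)
open import Data.Nat.Induction using (<-rec)
open import Data.Nat.Primality using (Prime; euclidsLemma; prime⇒nonTrivial; prime⇒nonZero)
open import Data.Nat.Primality.Factorisation using (factorise)
import Data.Nat.Properties as ℕ
open import Data.Nat.Tactic.RingSolver using (solve-∀)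
open import Data.Product.Base using (_×_; _,_; ∃-syntax; proj₁; proj₂; swap)
open import Data.Product.Function.NonDependent.Propositional using (_×-⇔_)
open import Data.Rational.Base using (mkℚ; mkℚ+; *<*)
import Data.Rational.Base as ℚ
import Data.Rational.Properties as ℚ
import Data.Rational.Unnormalised.Base as ℚᵘ
import Data.Rational.Unnormalised.Properties as ℚᵘ
open import Data.Sum.Base using (_⊎_; inj₁; inj₂; [_,_]′)
open import Data.Sum.Function.Propositional using (_⊎-⇔_)
open import Data.Vec.Base using (Vec; []; _∷_; lookup)
open import Function.Base using (_∘_; _$_; case_of_; id)
open import Function.Bundles using (_⇔_; mk⇔; Equivalence)
open import Function.Construct.Identity using (⇔-id)
import Function.Properties.Equivalence as ⇔
open import Function.Related.TypeIsomorphisms using (¬-cong-⇔; →-cong-⇔)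
open import Level using (0ℓ)
open import Relation.Binary.Definitions using (Trichotomous; Transitive; tri<; tri≈; tri>)
open import Relation.Binary.PropositionalEquality
  using (_≡_; refl; sym; trans; cong; cong₂; subst; subst₂; isEquivalence; module ≡-Reasoning)
open import Relation.Nullary using (¬_; Dec; yes; no; contradiction)
import Relation.Nullary.Decidable as Dec

-- Arithmetic of natural numbers

-- Connectives and quantifiers are read constructively, so the classical steps (De Morgan,
-- implication as disjunction, ∀ as ¬ ∃ ¬) rest on the decidability of quantifier-free formulas,
-- hence on deciding whether a rational is a k-th power. Passing to a common exponent is lossless
-- because taking powers is injective and strictly monotone; that y be an m-th power is no new kind
-- of condition, but the first coset. Order and cosets do not interact: a factor that is an N-th
-- power, with N a multiple of all exponents involved, changes no coset condition, so a point
-- satisfying these can be moved into any nonempty interval. Density is multiplicative: a geometric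
-- progression with ratio close enough to 1 cannot jump over the interval. The fresh prime comes
-- from Euclid's argument and depends on the parameters; only the criterion that it justifies enters
-- the formula.

^-distribʳ-* : ∀ a b n → (a * b) ℕ.^ n ≡ a ℕ.^ n * b ℕ.^ n
^-distribʳ-* a b zero    = refl
^-distribʳ-* a b (suc n) =
  trans (cong (a * b *_) (^-distribʳ-* a b n)) (lemma a b (a ℕ.^ n) (b ℕ.^ n))
  where
  lemma : ∀ a b x y → a * b * (x * y) ≡ a * x * (b * y)
  lemma = solve-∀

coprime-divisor-^ : ∀ {d e} n → Coprime d e → d ∣ e ℕ.^ n → d ≡ 1
coprime-divisor-^ zero    d⊥e d∣1  = ∣1⇒≡1 d∣1
coprime-divisor-^ (suc n) d⊥e d∣eⁿ = coprime-divisor-^ n d⊥e (coprime-divisor d⊥e d∣eⁿ)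

-- Dividing out the gcd makes the bases coprime; then `d′` divides a power of `e′` and must be 1.
-- This is why a rational root of a natural number is natural, as `IsPow?` needs.
^-cancel-∣ : ∀ n {d e} .{{_ : NonZero d}} → d ℕ.^ suc n ∣ e ℕ.^ suc n → d ∣ e
^-cancel-∣ n {d} {e} dⁿ∣eⁿ with mkGCD d e
... | g , gcd with GCD.commonDivisor gcd
... | divides d′ refl , divides e′ refl =
  subst (λ d → d * g ∣ e′ * g) (sym d′≡1) (*-monoˡ-∣ g (divides e′ (sym (ℕ.*-identityʳ e′))))
  where
  instance
    g≢0 : NonZero g
    g≢0 = ℕ.m*n≢0⇒n≢0 d′
    gⁿ≢0 : NonZero (g ℕ.^ suc n)
    gⁿ≢0 = ℕ.m^n≢0 g (suc n)
  d′⊥e′ : Coprime d′ e′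
  d′⊥e′ = GCD≡1⇒coprime (GCD-* (subst (GCD (d′ * g) (e′ * g)) (sym (ℕ.*-identityˡ g)) gcd))
  swap-^ : ∀ a → (a * g) ℕ.^ suc n ≡ g ℕ.^ suc n * a ℕ.^ suc n
  swap-^ a = trans (^-distribʳ-* a g (suc n)) (ℕ.*-comm (a ℕ.^ suc n) (g ℕ.^ suc n))
  d′≡1 : d′ ≡ 1
  d′≡1 = coprime-divisor-^ (suc n) d′⊥e′ (∣-trans (m∣m*n (d′ ℕ.^ n))
    (*-cancelˡ-∣ (g ℕ.^ suc n) (subst₂ _∣_ (swap-^ d′) (swap-^ e′) dⁿ∣eⁿ)))

-- Bernoulli's inequality 1 + j/b ≤ (1 + 1/b)^j, multiplied by b^(1+j).
bernoulli : ∀ b j → b ℕ.^ j * (b + j) ≤ b * suc b ℕ.^ j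
bernoulli b zero    = ℕ.≤-reflexive (lemma b)
  where
  lemma : ∀ b → 1 * (b + 0) ≡ b * 1
  lemma = solve-∀
bernoulli b (suc j) = begin
  b * P * (b + suc j)           ≤⟨ ℕ.m≤m+n _ (P * j) ⟩
  b * P * (b + suc j) + P * j   ≡⟨ lemma₁ b j P ⟩
  P * (b + j) * suc b           ≤⟨ ℕ.*-monoˡ-≤ (suc b) (bernoulli b j) ⟩
  b * Q * suc b                 ≡⟨ lemma₂ b Q ⟩
  b * (suc b * Q)               ∎
  where
  open ℕ.≤-Reasoning
  P = b ℕ.^ j
  Q = suc b ℕ.^ j
  lemma₁ : ∀ b j P → b * P * (b + suc j) + P * j ≡ P * (b + j) * suc b
  lemma₁ = solve-∀
  lemma₂ : ∀ b Q → b * Q * suc b ≡ b * (suc b * Q)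
  lemma₂ = solve-∀

prime-divisor : ∀ n → 1 < n → ∃[ p ] Prime p × p ∣ n
prime-divisor n 1<n with factorise n {{ℕ.>-nonZero (ℕ.<-trans ℕ.z<s 1<n)}}
... | record { factors = [] ; isFactorisation = refl } = contradiction 1<n (ℕ.<-irrefl refl)
... | record { factors = p ∷ ps ; isFactorisation = refl ; factorsPrime = pp ∷ _ } =
  p , pp , m∣m*n _

-- p-adic valuations

module _ {p : ℕ} (prime : Prime p) where
  private instance
    p≢0 : NonZero p
    p≢0 = prime⇒nonZero prime

  ∤-* : ∀ {a b} → p ∤ a → p ∤ b → p ∤ a * b
  ∤-* {a} {b} p∤a p∤b = [ p∤a , p∤b ]′ ∘ euclidsLemma a b prime

  ∤-^ : ∀ {a} n → p ∤ a → p ∤ a ℕ.^ n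
  ∤-^ zero    p∤a p∣1 = ℕ.<-irrefl (sym (∣1⇒≡1 p∣1)) (ℕ.nonTrivial⇒n>1 p {{prime⇒nonTrivial prime}})
  ∤-^ (suc n) p∤a = ∤-* p∤a (∤-^ n p∤a)

  valuation : ∀ a .{{_ : NonZero a}} → ∃[ i ] ∃[ a′ ] p ∤ a′ × a ≡ p ℕ.^ i * a′
  valuation a = <-rec (λ a → .{{_ : NonZero a}} → ∃[ i ] ∃[ a′ ] p ∤ a′ × a ≡ p ℕ.^ i * a′) step a
    where
    step : ∀ a → (∀ {b} → b < a → .{{_ : NonZero b}} → ∃[ i ] ∃[ b′ ] p ∤ b′ × b ≡ p ℕ.^ i * b′) →
           .{{_ : NonZero a}} → ∃[ i ] ∃[ a′ ] p ∤ a′ × a ≡ p ℕ.^ i * a′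
    step a rec with p ∣? a
    ... | no p∤a = 0 , a , p∤a , sym (ℕ.*-identityˡ a)
    ... | yes (divides b refl)
      with rec {b} (ℕ.m<m*n b p {{b≢0}} (ℕ.nonTrivial⇒n>1 p {{prime⇒nonTrivial prime}})) {{b≢0}}
      where
      b≢0 : NonZero b
      b≢0 = ℕ.m*n≢0⇒m≢0 b
    ...   | i , b′ , p∤b′ , refl = suc i , b′ , p∤b′ ,
      trans (ℕ.*-comm _ p) (sym (ℕ.*-assoc p (p ℕ.^ i) b′))

  valuation-unique : ∀ i j {a b} → p ∤ a → p ∤ b → p ℕ.^ i * a ≡ p ℕ.^ j * b → i ≡ j
  valuation-unique zero    zero    p∤a p∤b eq = refl
  valuation-unique zero    (suc j) {a} {b} p∤a p∤b eq = contradiction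
    (subst (p ∣_) (trans (sym eq) (ℕ.*-identityˡ a)) (∣m⇒∣m*n b (m∣m*n (p ℕ.^ j)))) p∤a
  valuation-unique (suc i) zero    {a} {b} p∤a p∤b eq = contradiction
    (subst (p ∣_) (trans eq (ℕ.*-identityˡ b)) (∣m⇒∣m*n a (m∣m*n (p ℕ.^ i)))) p∤b
  valuation-unique (suc i) (suc j) {a} {b} p∤a p∤b eq = cong suc $ valuation-unique i j p∤a p∤b $
    ℕ.*-cancelˡ-≡ _ _ p $ trans (sym (ℕ.*-assoc p (p ℕ.^ i) a)) (trans eq (ℕ.*-assoc p (p ℕ.^ j) b))

  -- Compare the p-adic valuations of both sides.
  valuation-∣ : ∀ K k {a b e f} .{{_ : NonZero e}} .{{_ : NonZero f}} → p ∤ a → p ∤ b →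
                p ℕ.^ K * a * f ℕ.^ k ≡ e ℕ.^ k * b → k ∣ K
  valuation-∣ K k {a} {b} {e} {f} p∤a p∤b eq with valuation e | valuation f
  ... | i , e′ , p∤e′ , refl | j , f′ , p∤f′ , refl =
    ∣m+n∣m⇒∣n (subst (k ∣_) (trans (sym exponents) (ℕ.+-comm K (j * k))) (n∣m*n i)) (n∣m*n j)
    where
    open ≡-Reasoning
    shuffle₁ : ∀ x y a f → x * y * (a * f) ≡ x * a * (y * f)
    shuffle₁ = solve-∀
    shuffle₂ : ∀ x e b → x * e * b ≡ x * (e * b)
    shuffle₂ = solve-∀
    split : ∀ i e → (p ℕ.^ i * e) ℕ.^ k ≡ p ℕ.^ (i * k) * e ℕ.^ k
    split i e = trans (^-distribʳ-* (p ℕ.^ i) e k) (cong (_* e ℕ.^ k) (ℕ.^-*-assoc p i k))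
    exponents : K + j * k ≡ i * k
    exponents = valuation-unique (K + j * k) (i * k) (∤-* p∤a (∤-^ k p∤f′)) (∤-* (∤-^ k p∤e′) p∤b) (begin
      p ℕ.^ (K + j * k) * (a * f′ ℕ.^ k)         ≡⟨ cong (_* (a * f′ ℕ.^ k)) (ℕ.^-distribˡ-+-* p K (j * k)) ⟩
      p ℕ.^ K * p ℕ.^ (j * k) * (a * f′ ℕ.^ k)   ≡⟨ shuffle₁ (p ℕ.^ K) (p ℕ.^ (j * k)) a (f′ ℕ.^ k) ⟩
      p ℕ.^ K * a * (p ℕ.^ (j * k) * f′ ℕ.^ k)   ≡⟨ cong (p ℕ.^ K * a *_) (split j f′) ⟨
      p ℕ.^ K * a * (p ℕ.^ j * f′) ℕ.^ k         ≡⟨ eq ⟩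
      (p ℕ.^ i * e′) ℕ.^ k * b                   ≡⟨ cong (_* b) (split i e′) ⟩
      p ℕ.^ (i * k) * e′ ℕ.^ k * b               ≡⟨ shuffle₂ (p ℕ.^ (i * k)) (e′ ℕ.^ k) b ⟩
      p ℕ.^ (i * k) * (e′ ℕ.^ k * b)             ∎)

-- Free of subtraction, so the two arguments play different roles; the Euclidean algorithm returns
-- one orientation or the other, whence the sum in `bézout`. The identity makes `m′` and `n′`
-- coprime and `g` the gcd.
record BézoutIdentity (m n : ℕ) : Set where
  constructor bézoutIdentity
  field
    g m′ n′ α β : ℕ
    m≡ : m ≡ m′ * g
    n≡ : n ≡ n′ * g
    identity : α * m′ ≡ 1 + β * n′

bézout : ∀ m n .{{_ : NonZero m}} → BézoutIdentity m n ⊎ BézoutIdentity n m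
bézout m n with Bézout.lemma m n
... | Bézout.result g gcd identity with GCD.commonDivisor gcd
... | divides m′ refl , divides n′ refl = orient identity
  where
  cancel : ∀ α m β n → g + β * (n * g) ≡ α * (m * g) → α * m ≡ 1 + β * n
  cancel α m β n eq = ℕ.*-cancelʳ-≡ _ _ g {{ℕ.m*n≢0⇒n≢0 m′}} $
    trans (ℕ.*-assoc α m g) (trans (sym eq) (cong (g +_) (sym (ℕ.*-assoc β n g))))
  orient : Bézout.Identity g (m′ * g) (n′ * g) →
           BézoutIdentity (m′ * g) (n′ * g) ⊎ BézoutIdentity (n′ * g) (m′ * g)
  orient (Bézout.+- α β eq) = inj₁ (bézoutIdentity g m′ n′ α β refl refl (cancel α m′ β n′ eq))
  orient (Bézout.-+ α β eq) = inj₂ (bézoutIdentity g n′ m′ β α refl refl (cancel β n′ α m′ eq))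

-- Ordered groups of positive fractions

-- An interface satisfied by ℚ⁺ only, up to isomorphism. Working over it keeps
-- the arithmetic of ℚ from unfolding.
record PositiveFractions : Set₁ where
  infixl 7 _∙_
  infix  10 _⁻
  infix  4 _⊏_
  field
    Carrier        : Set
    _∙_            : Carrier → Carrier → Carrier
    ε              : Carrier
    _⁻             : Carrier → Carrier
    _⊏_            : Carrier → Carrier → Set
    isAbelianGroup : IsAbelianGroup _≡_ _∙_ ε _⁻
    compare        : Trichotomous _≡_ _⊏_
    ⊏-trans        : Transitive _⊏_
    ∙-monoˡ-⊏      : ∀ z {x y} → x ⊏ y → x ∙ z ⊏ y ∙ z
    ι              : (a : ℕ) .{{_ : NonZero a}} → Carrier
    ι-*            : ∀ a b .{{_ : NonZero a}} .{{_ : NonZero b}} →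
                     ι (a * b) {{ℕ.m*n≢0 a b}} ≡ ι a ∙ ι b
    ι-mono-⊏       : ∀ {a b} .{{_ : NonZero a}} .{{_ : NonZero b}} → a < b → ι a ⊏ ι b
    fraction       : ∀ x → ∃[ a ] ∃[ b ] ∃[ a≢0 ] ∃[ b≢0 ] x ∙ ι b {{b≢0}} ≡ ι a {{a≢0}}

module FractionGroup (F : PositiveFractions) where
  open PositiveFractions F public
  private
    abelianGroup : AbelianGroup 0ℓ 0ℓ
    abelianGroup = record { isAbelianGroup = isAbelianGroup }

  open AbelianGroup abelianGroup public
    using (inverseʳ; inverseˡ; identityˡ; identityʳ; comm; assoc)
  open AbelianGroup abelianGroup using (commutativeMonoid; group; commutativeSemigroup)
  open import Algebra.Properties.Group group public
    using (∙-cancelʳ; inverseˡ-unique; identityʳ-unique; \\-leftDividesʳ)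
  open import Algebra.Properties.CommutativeSemigroup commutativeSemigroup public
    using (interchange; xy∙z≈xz∙y)
  open import Algebra.Properties.CommutativeMonoid.Mult commutativeMonoid
    using (×-homo-+; ×-assocˡ; ×-distrib-+) renaming (_×_ to _×ᴳ_)
  import Algebra.Solver.CommutativeMonoid commutativeMonoid as M
  import Algebra.Solver.CommutativeMonoid.Normal commutativeMonoid as Normal

  infixl 9 _^_
  _^_ : Carrier → ℕ → Carrier
  x ^ n = n ×ᴳ x

  ^-+ : ∀ x m n → x ^ (m + n) ≡ x ^ m ∙ x ^ n
  ^-+ = ×-homo-+

  ^-^ : ∀ x m n → x ^ m ^ n ≡ x ^ (n * m)
  ^-^ x m n = ×-assocˡ x n m

  ^-∙ : ∀ x y n → (x ∙ y) ^ n ≡ x ^ n ∙ y ^ n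
  ^-∙ = ×-distrib-+

  ε^ : ∀ n → ε ^ n ≡ ε
  ε^ zero    = refl
  ε^ (suc n) = trans (identityˡ _) (ε^ n)

  ^-⁻ : ∀ x n → (x ⁻) ^ n ≡ (x ^ n) ⁻
  ^-⁻ x n = inverseˡ-unique _ _ (trans (sym (^-∙ (x ⁻) x n)) (trans (cong (_^ n) (inverseˡ x)) (ε^ n)))

  -- Terms of the object language double as the reflected syntax of `solve`.
  ⟪_⟫ : ∀ {n} → Term n → Vec Carrier n → Carrier
  ⟪ var i ⟫ ρ = lookup ρ i
  ⟪ 𝟏 ⟫     ρ = ε
  ⟪ s · t ⟫ ρ = ⟪ s ⟫ ρ ∙ ⟪ t ⟫ ρ
  ⟪ t ⁻¹ ⟫  ρ = ⟪ t ⟫ ρ ⁻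

  -- A solver for identities in abelian groups: write both sides as fractions
  -- of monoid expressions and compare the cross products.
  num den : ∀ {n} → Term n → M.Expr n
  num (var i) = M.var i
  num 𝟏       = M.id
  num (s · t) = num s M.⊕ num t
  num (t ⁻¹)  = den t
  den (var i) = M.id
  den 𝟏       = M.id
  den (s · t) = den s M.⊕ den t
  den (t ⁻¹)  = num t

  term-fraction : ∀ {n} (t : Term n) ρ → ⟪ t ⟫ ρ ∙ M.⟦ den t ⟧ ρ ≡ M.⟦ num t ⟧ ρ
  term-fraction (var i) ρ = identityʳ _
  term-fraction 𝟏       ρ = identityʳ _
  term-fraction (s · t) ρ =
    trans (interchange _ _ _ _) (cong₂ _∙_ (term-fraction s ρ) (term-fraction t ρ))
  term-fraction (t ⁻¹)  ρ =
    trans (cong (⟪ t ⟫ ρ ⁻ ∙_) (sym (term-fraction t ρ))) (\\-leftDividesʳ _ _)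

  solve : ∀ {n} (ρ : Vec Carrier n) (s t : Term n) →
          M.normalise (num s M.⊕ den t) ≡ M.normalise (num t M.⊕ den s) → ⟪ s ⟫ ρ ≡ ⟪ t ⟫ ρ
  solve ρ s t eq = ∙-cancelʳ (M.⟦ den s ⟧ ρ ∙ M.⟦ den t ⟧ ρ) _ _ $ begin
    ⟪ s ⟫ ρ ∙ (M.⟦ den s ⟧ ρ ∙ M.⟦ den t ⟧ ρ)  ≡⟨ assoc _ _ _ ⟨
    ⟪ s ⟫ ρ ∙ M.⟦ den s ⟧ ρ ∙ M.⟦ den t ⟧ ρ    ≡⟨ cong (_∙ _) (term-fraction s ρ) ⟩
    M.⟦ num s M.⊕ den t ⟧ ρ                    ≡⟨ Normal.correct (num s M.⊕ den t) ρ ⟨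
    M.⟦ M.normalise (num s M.⊕ den t) ⟧⇓ ρ     ≡⟨ cong (λ e → M.⟦ e ⟧⇓ ρ) eq ⟩
    M.⟦ M.normalise (num t M.⊕ den s) ⟧⇓ ρ     ≡⟨ Normal.correct (num t M.⊕ den s) ρ ⟩
    M.⟦ num t M.⊕ den s ⟧ ρ                    ≡⟨ cong (_∙ _) (term-fraction t ρ) ⟨
    ⟪ t ⟫ ρ ∙ M.⟦ den t ⟧ ρ ∙ M.⟦ den s ⟧ ρ    ≡⟨ assoc _ _ _ ⟩
    ⟪ t ⟫ ρ ∙ (M.⟦ den t ⟧ ρ ∙ M.⟦ den s ⟧ ρ)  ≡⟨ cong (⟪ t ⟫ ρ ∙_) (comm _ _) ⟩
    ⟪ t ⟫ ρ ∙ (M.⟦ den s ⟧ ρ ∙ M.⟦ den t ⟧ ρ)  ∎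
    where open ≡-Reasoning

  pattern X = var 0F
  pattern Y = var 1F
  pattern Z = var 2F
  pattern W = var 3F

  ⊏-irrefl : ∀ {x} → ¬ (x ⊏ x)
  ⊏-irrefl {x} x⊏x with compare x x
  ... | tri< _ x≢x _ = x≢x refl
  ... | tri≈ x⊏̸x _ _ = x⊏̸x x⊏x
  ... | tri> _ x≢x _ = x≢x refl

  _⊏?_ : ∀ x y → Dec (x ⊏ y)
  x ⊏? y with compare x y
  ... | tri< x⊏y _ _ = yes x⊏y
  ... | tri≈ x⊏̸y _ _ = no x⊏̸y
  ... | tri> x⊏̸y _ _ = no x⊏̸y

  _≟_ : ∀ (x y : Carrier) → Dec (x ≡ y)
  x ≟ y with compare x y
  ... | tri< _ x≢y _ = no x≢y
  ... | tri≈ _ x≡y _ = yes x≡y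
  ... | tri> _ x≢y _ = no x≢y

  infix 4 _⊑_ _⊏?_ _≟_
  _⊑_ : Carrier → Carrier → Set
  x ⊑ y = ¬ (y ⊏ x)

  ⊏-asym : ∀ {x y} → x ⊏ y → x ⊑ y
  ⊏-asym x⊏y y⊏x = ⊏-irrefl (⊏-trans x⊏y y⊏x)

  ⊑-⊏-trans : ∀ {x y z} → x ⊑ y → y ⊏ z → x ⊏ z
  ⊑-⊏-trans {x} {y} x⊑y y⊏z with compare x y
  ... | tri< x⊏y _ _    = ⊏-trans x⊏y y⊏z
  ... | tri≈ _ refl _   = y⊏z
  ... | tri> _ _ y⊏x    = contradiction y⊏x x⊑y

  ⊏-⊑-trans : ∀ {x y z} → x ⊏ y → y ⊑ z → x ⊏ z
  ⊏-⊑-trans {x} {y} {z} x⊏y y⊑z with compare y z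
  ... | tri< y⊏z _ _    = ⊏-trans x⊏y y⊏z
  ... | tri≈ _ refl _   = x⊏y
  ... | tri> _ _ z⊏y    = contradiction z⊏y y⊑z

  ⊑-trans : ∀ {x y z} → x ⊑ y → y ⊑ z → x ⊑ z
  ⊑-trans x⊑y y⊑z z⊏x = x⊑y (⊑-⊏-trans y⊑z z⊏x)

  ∙-cancelʳ-⊏ : ∀ z {x y} → x ∙ z ⊏ y ∙ z → x ⊏ y
  ∙-cancelʳ-⊏ z {x} {y} = subst₂ _⊏_ (cancel x) (cancel y) ∘ ∙-monoˡ-⊏ (z ⁻)
    where
    cancel : ∀ x → x ∙ z ∙ z ⁻ ≡ x
    cancel x = solve (x ∷ z ∷ []) (X · Y · Y ⁻¹) X refl

  ⊏-scale : ∀ z {x y x′ y′} → x ∙ z ≡ x′ → y ∙ z ≡ y′ → (x ⊏ y) ⇔ (x′ ⊏ y′)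
  ⊏-scale z refl refl = mk⇔ (∙-monoˡ-⊏ z) (∙-cancelʳ-⊏ z)

  ∙-mono-⊏ : ∀ {x y u v} → x ⊏ y → u ⊏ v → x ∙ u ⊏ y ∙ v
  ∙-mono-⊏ {x} {y} {u} {v} x⊏y u⊏v =
    ⊏-trans (∙-monoˡ-⊏ u x⊏y) (subst₂ _⊏_ (comm u y) (comm v y) (∙-monoˡ-⊏ y u⊏v))

  ^-monoˡ-⊏ : ∀ n {x y} → x ⊏ y → x ^ suc n ⊏ y ^ suc n
  ^-monoˡ-⊏ zero    x⊏y = ∙-monoˡ-⊏ ε x⊏y
  ^-monoˡ-⊏ (suc n) x⊏y = ∙-mono-⊏ x⊏y (^-monoˡ-⊏ n x⊏y)

  ^-cancelˡ-⊏ : ∀ n {x y} → x ^ n ⊏ y ^ n → x ⊏ y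
  ^-cancelˡ-⊏ zero    ε⊏ε = contradiction ε⊏ε ⊏-irrefl
  ^-cancelˡ-⊏ (suc n) {x} {y} xⁿ⊏yⁿ with compare x y
  ... | tri< x⊏y _ _  = x⊏y
  ... | tri≈ _ refl _ = contradiction xⁿ⊏yⁿ ⊏-irrefl
  ... | tri> _ _ y⊏x  = contradiction xⁿ⊏yⁿ (⊏-asym (^-monoˡ-⊏ n y⊏x))

  ^-injective : ∀ n {x y} → x ^ suc n ≡ y ^ suc n → x ≡ y
  ^-injective n {x} {y} xⁿ≡yⁿ with compare x y
  ... | tri< x⊏y _ _ = contradiction (subst (_⊏ y ^ suc n) xⁿ≡yⁿ (^-monoˡ-⊏ n x⊏y)) ⊏-irrefl
  ... | tri≈ _ x≡y _ = x≡y
  ... | tri> _ _ y⊏x = contradiction (subst (y ^ suc n ⊏_) xⁿ≡yⁿ (^-monoˡ-⊏ n y⊏x)) ⊏-irrefl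

  record IsPow (k : ℕ) (x : Carrier) : Set where
    constructor root
    field
      base : Carrier
      ≡^   : x ≡ base ^ k

  IsPow-^ : ∀ k x → IsPow k (x ^ k)
  IsPow-^ k x = root x refl

  IsPow-∙ : ∀ k {x y} → IsPow k x → IsPow k y → IsPow k (x ∙ y)
  IsPow-∙ k (root a refl) (root b refl) = root (a ∙ b) (sym (^-∙ a b k))

  IsPow-⁻ : ∀ k {x} → IsPow k x → IsPow k (x ⁻)
  IsPow-⁻ k (root a refl) = root (a ⁻) (sym (^-⁻ a k))

  IsPow-*ʳ : ∀ {m k x} → IsPow (m * k) x → IsPow k x
  IsPow-*ʳ {m} {k} (root a refl) =
    root (a ^ m) (sym (trans (^-^ a m k) (cong (a ^_) (ℕ.*-comm k m))))

  IsPow-∣ : ∀ {m k x} → m ∣ k → IsPow k x → IsPow m x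
  IsPow-∣ {m} (divides q refl) = IsPow-*ʳ {q} {m}

  IsPow-shift : ∀ k {x y z} → IsPow k z → x ∙ z ≡ y → IsPow k x ⇔ IsPow k y
  IsPow-shift k {x} {y} {z} pz refl = mk⇔ (λ px → IsPow-∙ k px pz) λ py →
    subst (IsPow k) (solve (x ∷ z ∷ []) (X · Y · Y ⁻¹) X refl) (IsPow-∙ k py (IsPow-⁻ k pz))

  -- The way back extracts (1+d)-th roots from an equation: an ordered group is torsion-free.
  IsPow-scale : ∀ d k x → IsPow k x ⇔ IsPow (suc d * k) (x ^ suc d)
  IsPow-scale d k x = mk⇔
    (λ (root a eq) → root a (trans (cong (_^ suc d) eq) (^-^ a k (suc d))))
    (λ (root a eq) → root a (^-injective d (trans eq (sym (^-^ a k (suc d))))))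

  ι-cong : ∀ {a b} .{{_ : NonZero a}} .{{_ : NonZero b}} → a ≡ b → ι a ≡ ι b
  ι-cong refl = refl

  ι-injective : ∀ {a b} .{{_ : NonZero a}} .{{_ : NonZero b}} → ι a ≡ ι b → a ≡ b
  ι-injective {a} {b} ιa≡ιb with ℕ.<-cmp a b
  ... | tri< a<b _ _ = contradiction (subst (_⊏ ι b) ιa≡ιb (ι-mono-⊏ a<b)) ⊏-irrefl
  ... | tri≈ _ a≡b _ = a≡b
  ... | tri> _ _ b<a = contradiction (subst (ι b ⊏_) ιa≡ιb (ι-mono-⊏ b<a)) ⊏-irrefl

  ι-cancel-⊏ : ∀ {a b} .{{_ : NonZero a}} .{{_ : NonZero b}} → ι a ⊏ ι b → a < b
  ι-cancel-⊏ {a} {b} ιa⊏ιb with ℕ.<-cmp a b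
  ... | tri< a<b _ _  = a<b
  ... | tri≈ _ refl _ = contradiction ιa⊏ιb ⊏-irrefl
  ... | tri> _ _ b<a  = contradiction ιa⊏ιb (⊏-asym (ι-mono-⊏ b<a))

  ι-1 : ι 1 ≡ ε
  ι-1 = identityʳ-unique (ι 1) (ι 1) (sym (ι-* 1 1))

  ι-^ : ∀ a n .{{_ : NonZero a}} → ι (a ℕ.^ n) {{ℕ.m^n≢0 a n}} ≡ ι a ^ n
  ι-^ a zero    = ι-1
  ι-^ a (suc n) = trans (ι-* a (a ℕ.^ n) {{_}} {{ℕ.m^n≢0 a n}}) (cong (ι a ∙_) (ι-^ a n))

-- Decidability and density of n-th powers

module Powers (F : PositiveFractions) where
  open FractionGroup F

  -- For x = a/b, multiplication by b^(1+k) replaces x by the natural number n = a b^k. A rational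
  -- root c of n is natural and satisfies c ≤ n, so a finite search decides.
  IsPow? : ∀ k x → Dec (IsPow (suc k) x)
  IsPow? k x with fraction x
  ... | a , b , a≢0 , b≢0 , x∙b≡a = Dec.map′ from to (ℕ.anyUpTo? (λ c → c ℕ.^ suc k ℕ.≟ n) (suc n))
    where
    open ≡-Reasoning
    instance
      _ = a≢0
      _ = b≢0
      b^k≢0 : NonZero (b ℕ.^ k)
      b^k≢0 = ℕ.m^n≢0 b k
    n = a * b ℕ.^ k
    instance
      n≢0 : NonZero n
      n≢0 = ℕ.m*n≢0 a (b ℕ.^ k)
    ιn : ι n ≡ x ∙ ι b ^ suc k
    ιn = begin
      ι n                       ≡⟨ ι-* a (b ℕ.^ k) ⟩
      ι a ∙ ι (b ℕ.^ k)         ≡⟨ cong₂ _∙_ (sym x∙b≡a) (ι-^ b k) ⟩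
      x ∙ ι b ∙ ι b ^ k         ≡⟨ assoc _ _ _ ⟩
      x ∙ ι b ^ suc k           ∎
    from : ∃[ c ] c < suc n × c ℕ.^ suc k ≡ n → IsPow (suc k) x
    from (c , _ , cᵏ≡n) = root (ι c ∙ ι b ⁻) $ ∙-cancelʳ (ι b ^ suc k) _ _ (begin
      x ∙ ι b ^ suc k                          ≡⟨ ιn ⟨
      ι n                                      ≡⟨ ι-cong cᵏ≡n ⟨
      ι (c ℕ.^ suc k)                          ≡⟨ ι-^ c (suc k) ⟩
      ι c ^ suc k                              ≡⟨ cong (_^ suc k) (solve (ι c ∷ ι b ∷ []) X (X · Y ⁻¹ · Y) refl) ⟩
      (ι c ∙ ι b ⁻ ∙ ι b) ^ suc k              ≡⟨ ^-∙ _ (ι b) (suc k) ⟩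
      (ι c ∙ ι b ⁻) ^ suc k ∙ ι b ^ suc k      ∎)
      where
      nonZero : NonZero c
      nonZero = ℕ.m*n≢0⇒m≢0 c {{subst NonZero (sym cᵏ≡n) n≢0}}
      instance
        c≢0 : NonZero c
        c≢0 = nonZero
        cᵏ≢0 : NonZero (c ℕ.^ suc k)
        cᵏ≢0 = ℕ.m^n≢0 c (suc k)
    to : IsPow (suc k) x → ∃[ c ] c < suc n × c ℕ.^ suc k ≡ n
    to (root y x≡yᵏ) with fraction y
    -- The natural root is y b = e b / f: the (1+k)-th power of f divides that of e b, hence f
    -- divides e b.
    ... | e , f , e≢0 , f≢0 , y∙f≡e = nat-root (^-cancel-∣ k {f} {e * b} (divides n ebᵏ≡nfᵏ))
      where
      instance
        _ = e≢0
        _ = f≢0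
        eb≢0 : NonZero (e * b)
        eb≢0 = ℕ.m*n≢0 e b
        fᵏ≢0 : NonZero (f ℕ.^ suc k)
        fᵏ≢0 = ℕ.m^n≢0 f (suc k)
        ebᵏ≢0 : NonZero ((e * b) ℕ.^ suc k)
        ebᵏ≢0 = ℕ.m^n≢0 (e * b) (suc k)
        nfᵏ≢0 : NonZero (n * f ℕ.^ suc k)
        nfᵏ≢0 = ℕ.m*n≢0 n (f ℕ.^ suc k)
      ebᵏ≡nfᵏ : (e * b) ℕ.^ suc k ≡ n * f ℕ.^ suc k
      ebᵏ≡nfᵏ = ι-injective (begin
        ι ((e * b) ℕ.^ suc k)                       ≡⟨ ι-^ (e * b) (suc k) ⟩
        ι (e * b) ^ suc k                           ≡⟨ cong (_^ suc k) (ι-* e b) ⟩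
        (ι e ∙ ι b) ^ suc k                         ≡⟨ cong (λ z → (z ∙ ι b) ^ suc k) y∙f≡e ⟨
        (y ∙ ι f ∙ ι b) ^ suc k                     ≡⟨ ^-∙ (y ∙ ι f) (ι b) (suc k) ⟩
        (y ∙ ι f) ^ suc k ∙ ι b ^ suc k             ≡⟨ cong (_∙ ι b ^ suc k) (^-∙ y (ι f) (suc k)) ⟩
        y ^ suc k ∙ ι f ^ suc k ∙ ι b ^ suc k       ≡⟨ xy∙z≈xz∙y _ _ _ ⟩
        y ^ suc k ∙ ι b ^ suc k ∙ ι f ^ suc k       ≡⟨ cong (λ z → z ∙ ι b ^ suc k ∙ ι f ^ suc k) x≡yᵏ ⟨
        x ∙ ι b ^ suc k ∙ ι f ^ suc k               ≡⟨ cong₂ _∙_ (sym ιn) (sym (ι-^ f (suc k))) ⟩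
        ι n ∙ ι (f ℕ.^ suc k)                       ≡⟨ ι-* n (f ℕ.^ suc k) ⟨
        ι (n * f ℕ.^ suc k)                         ∎)
      nat-root : f ∣ e * b → ∃[ c ] c < suc n × c ℕ.^ suc k ≡ n
      nat-root (divides c eb≡cf) = c , ℕ.s≤s (subst (c ≤_) cᵏ≡n (m≤m^[1+k] c)) , cᵏ≡n
        where
        cᵏ≡n : c ℕ.^ suc k ≡ n
        cᵏ≡n = ℕ.*-cancelʳ-≡ _ _ (f ℕ.^ suc k) (begin
          c ℕ.^ suc k * f ℕ.^ suc k   ≡⟨ ^-distribʳ-* c f (suc k) ⟨
          (c * f) ℕ.^ suc k           ≡⟨ cong (ℕ._^ suc k) eb≡cf ⟨
          (e * b) ℕ.^ suc k           ≡⟨ ebᵏ≡nfᵏ ⟩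
          n * f ℕ.^ suc k             ∎)
        m≤m^[1+k] : ∀ m → m ≤ m ℕ.^ suc k
        m≤m^[1+k] zero    = ℕ.z≤n
        m≤m^[1+k] (suc m) = ℕ.m≤m*n (suc m) (suc m ℕ.^ k) {{ℕ.m^n≢0 (suc m) k}}

  -- The arithmetic mean of 1 and r = a/b. The interface has no addition, so it is formed from
  -- numerators and denominators as (a + b) / (2 b).
  between : ∀ {r} → ε ⊏ r → ∃[ m ] ε ⊏ m × m ⊏ r
  between {r} ε⊏r with fraction r
  ... | a , b , a≢0 , b≢0 , r∙b≡a = ι (a + b) ∙ ι (2 * b) ⁻ , ε⊏m , m⊏r
    where
    instance
      _ = a≢0
      _ = b≢0
      a+b≢0 : NonZero (a + b)
      a+b≢0 = ℕ.>-nonZero (ℕ.≤-trans (ℕ.>-nonZero⁻¹ b) (ℕ.m≤n+m b a))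
      2b≢0 : NonZero (2 * b)
      2b≢0 = ℕ.m*n≢0 2 b
      2a≢0 : NonZero (2 * a)
      2a≢0 = ℕ.m*n≢0 2 a
    b<a : b < a
    b<a = ι-cancel-⊏ (subst₂ _⊏_ (identityˡ (ι b)) r∙b≡a (∙-monoˡ-⊏ (ι b) ε⊏r))
    m∙2b≡a+b : ι (a + b) ∙ ι (2 * b) ⁻ ∙ ι (2 * b) ≡ ι (a + b)
    m∙2b≡a+b = solve (ι (a + b) ∷ ι (2 * b) ∷ []) (X · Y ⁻¹ · Y) X refl
    r∙2b≡2a : r ∙ ι (2 * b) ≡ ι (2 * a)
    r∙2b≡2a = begin
      r ∙ ι (2 * b)      ≡⟨ cong (r ∙_) (ι-* 2 b) ⟩
      r ∙ (ι 2 ∙ ι b)    ≡⟨ solve (r ∷ ι 2 ∷ ι b ∷ []) (X · (Y · Z)) (Y · (X · Z)) refl ⟩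
      ι 2 ∙ (r ∙ ι b)    ≡⟨ cong (ι 2 ∙_) r∙b≡a ⟩
      ι 2 ∙ ι a          ≡⟨ ι-* 2 a ⟨
      ι (2 * a)          ∎
      where open ≡-Reasoning
    double : ∀ a → a + a ≡ 2 * a
    double = solve-∀
    ε⊏m : ε ⊏ ι (a + b) ∙ ι (2 * b) ⁻
    ε⊏m = ∙-cancelʳ-⊏ (ι (2 * b)) (subst₂ _⊏_ (sym (identityˡ _)) (sym m∙2b≡a+b)
      (ι-mono-⊏ (subst (_< a + b) (double b) (ℕ.+-monoˡ-< b b<a))))
    m⊏r : ι (a + b) ∙ ι (2 * b) ⁻ ⊏ r
    m⊏r = ∙-cancelʳ-⊏ (ι (2 * b)) (subst₂ _⊏_ (sym m∙2b≡a+b) (sym r∙2b≡2a)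
      (ι-mono-⊏ (subst (a + b <_) (double a) (ℕ.+-monoʳ-< a b<a))))

  -- Split r into m and r/m, both above 1, and take q with qⁿ < r/m. The smaller of m and q works:
  -- one factor is bounded by m, the other n by r/m.
  small-root : ∀ n {r} → ε ⊏ r → ∃[ q ] ε ⊏ q × q ^ n ⊏ r
  small-root zero    {r} ε⊏r = r , ε⊏r , ε⊏r
  small-root (suc n) {r} ε⊏r =
    case between ε⊏r of λ (m , ε⊏m , m⊏r) →
    case small-root n (subst (_⊏ r ∙ m ⁻) (inverseʳ m) (∙-monoˡ-⊏ (m ⁻) m⊏r)) of
      λ (q , ε⊏q , qⁿ⊏r/m) →
    let m∙r/m≡r = solve (m ∷ r ∷ []) (X · (Y · X ⁻¹)) Y refl in
    case q ⊏? m of λ where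
      (yes q⊏m) → q , ε⊏q , subst (q ^ suc n ⊏_) m∙r/m≡r (∙-mono-⊏ q⊏m qⁿ⊏r/m)
      (no  m⊑q) → m , ε⊏m , subst₂ _⊏_ (comm (m ^ n) m) (trans (comm (r ∙ m ⁻) m) m∙r/m≡r)
        (∙-monoˡ-⊏ m (⊑-⊏-trans (m⊑q ∘ ^-cancelˡ-⊏ n) qⁿ⊏r/m))

  archimedean : ∀ {q} s → ε ⊏ q → ∃[ j ] s ⊏ q ^ j
  archimedean {q} s ε⊏q with fraction q | fraction s
  ... | a , b , a≢0 , b≢0 , q∙b≡a | c , d , c≢0 , d≢0 , s∙d≡c =
    j , ∙-cancelʳ-⊏ (ι d ∙ ι b ^ j) (subst₂ _⊏_ (sym left) (sym right) (ι-mono-⊏ cbʲ<daʲ))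
    where
    -- As q ≥ 1 + 1/b, Bernoulli gives q^j ≥ 1 + j/b, and j = b c makes this 1 + c, which exceeds s
    -- = c/d.
    j = b * c
    instance
      _ = a≢0
      _ = b≢0
      _ = c≢0
      _ = d≢0
      aʲ≢0 : NonZero (a ℕ.^ j)
      aʲ≢0 = ℕ.m^n≢0 a j
      bʲ≢0 : NonZero (b ℕ.^ j)
      bʲ≢0 = ℕ.m^n≢0 b j
      cbʲ≢0 : NonZero (c * b ℕ.^ j)
      cbʲ≢0 = ℕ.m*n≢0 c (b ℕ.^ j)
      daʲ≢0 : NonZero (d * a ℕ.^ j)
      daʲ≢0 = ℕ.m*n≢0 d (a ℕ.^ j)
    b<a : b < a
    b<a = ι-cancel-⊏ (subst₂ _⊏_ (identityˡ (ι b)) q∙b≡a (∙-monoˡ-⊏ (ι b) ε⊏q))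
    left : s ∙ (ι d ∙ ι b ^ j) ≡ ι (c * b ℕ.^ j)
    left = begin
      s ∙ (ι d ∙ ι b ^ j)    ≡⟨ assoc _ _ _ ⟨
      s ∙ ι d ∙ ι b ^ j      ≡⟨ cong₂ _∙_ s∙d≡c (sym (ι-^ b j)) ⟩
      ι c ∙ ι (b ℕ.^ j)      ≡⟨ ι-* c (b ℕ.^ j) ⟨
      ι (c * b ℕ.^ j)        ∎
      where open ≡-Reasoning
    right : q ^ j ∙ (ι d ∙ ι b ^ j) ≡ ι (d * a ℕ.^ j)
    right = begin
      q ^ j ∙ (ι d ∙ ι b ^ j)    ≡⟨ solve (q ^ j ∷ ι d ∷ ι b ^ j ∷ []) (X · (Y · Z)) (Y · (X · Z)) refl ⟩
      ι d ∙ (q ^ j ∙ ι b ^ j)    ≡⟨ cong (ι d ∙_) (^-∙ q (ι b) j) ⟨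
      ι d ∙ (q ∙ ι b) ^ j        ≡⟨ cong (λ z → ι d ∙ z ^ j) q∙b≡a ⟩
      ι d ∙ ι a ^ j              ≡⟨ cong (ι d ∙_) (ι-^ a j) ⟨
      ι d ∙ ι (a ℕ.^ j)          ≡⟨ ι-* d (a ℕ.^ j) ⟨
      ι (d * a ℕ.^ j)            ∎
      where open ≡-Reasoning
    cbʲ<daʲ : c * b ℕ.^ j < d * a ℕ.^ j
    cbʲ<daʲ = begin-strict
      c * b ℕ.^ j      <⟨ ℕ.*-monoˡ-< (b ℕ.^ j) (ℕ.n<1+n c) ⟩
      suc c * b ℕ.^ j  ≤⟨ ℕ.*-cancelˡ-≤ b (ℕ.≤-trans (ℕ.≤-reflexive (lemma b c (b ℕ.^ j))) (bernoulli b j)) ⟩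
      suc b ℕ.^ j      ≤⟨ ℕ.^-monoˡ-≤ j b<a ⟩
      a ℕ.^ j          ≤⟨ ℕ.m≤n*m (a ℕ.^ j) d ⟩
      d * a ℕ.^ j      ∎
      where
      open ℕ.≤-Reasoning
      lemma : ∀ b c P → b * (suc c * P) ≡ P * (b + b * c)
      lemma = solve-∀

  ε⊏^ : ∀ n {q} → ε ⊏ q → ε ⊏ q ^ suc n
  ε⊏^ n {q} ε⊏q = subst (_⊏ q ^ suc n) (ε^ (suc n)) (^-monoˡ-⊏ n ε⊏q)

  ^-swap : ∀ q m n → q ^ m ^ n ≡ q ^ n ^ m
  ^-swap q m n = trans (^-^ q m n) (trans (cong (q ^_) (ℕ.*-comm n m)) (sym (^-^ q n m)))

  power-above : ∀ n {q} w s → ε ⊏ q → ∃[ j ] s ⊏ (w ∙ q ^ j) ^ suc n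
  power-above n {q} w s ε⊏q =
    case archimedean (s ∙ (w ^ suc n) ⁻) (ε⊏^ n ε⊏q) of λ (j , s/wⁿ⊏qⁿʲ) →
    j , subst₂ _⊏_
      (solve (s ∷ w ^ suc n ∷ []) (X · Y ⁻¹ · Y) X refl)
      (trans (cong (_∙ w ^ suc n) (^-swap q (suc n) j))
        (trans (comm _ _) (sym (^-∙ w (q ^ j) (suc n)))))
      (∙-monoˡ-⊏ (w ^ suc n) s/wⁿ⊏qⁿʲ)

  power-below : ∀ n {q} s → ε ⊏ q → ∃[ w ] w ^ suc n ⊏ s
  power-below n {q} s ε⊏q =
    case power-above n ε (s ⁻) ε⊏q of λ (j , s⁻⊏wⁿ) →
    let w = ε ∙ q ^ j in
    w ⁻ , subst₂ _⊏_
      (trans (solve (s ∷ w ^ suc n ∷ []) (X ⁻¹ · (X · Y ⁻¹)) (Y ⁻¹) refl) (sym (^-⁻ w (suc n))))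
      (solve (s ∷ w ^ suc n ∷ []) (Y · (X · Y ⁻¹)) X refl)
      (∙-monoˡ-⊏ (s ∙ (w ^ suc n) ⁻) s⁻⊏wⁿ)

  -- Follow w, w q, w q², ... up to the first term whose power exceeds s. The power of its
  -- predecessor is at most s, so its own is at most s q^(1+n) < t. The count `j` bounds the number
  -- of steps.
  climb : ∀ n {s t q} → s ∙ q ^ suc n ⊏ t →
          ∀ j w → w ^ suc n ⊑ s → s ⊏ (w ∙ q ^ j) ^ suc n → ∃[ w ] s ⊏ w ^ suc n × w ^ suc n ⊏ t
  climb n {s} sqⁿ⊏t zero w wⁿ⊑s s⊏ =
    contradiction (subst (λ z → s ⊏ z ^ suc n) (identityʳ w) s⊏) wⁿ⊑s
  climb n {s} {t} {q} sqⁿ⊏t (suc j) w wⁿ⊑s s⊏ with s ⊏? (w ∙ q) ^ suc n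
  ... | no  wqⁿ⊑s =
    climb n sqⁿ⊏t j (w ∙ q) wqⁿ⊑s (subst (λ z → s ⊏ z ^ suc n) (sym (assoc w q (q ^ j))) s⊏)
  ... | yes s⊏wqⁿ = w ∙ q , s⊏wqⁿ , subst (_⊏ t) (sym (^-∙ w q (suc n)))
    (⊑-⊏-trans (wⁿ⊑s ∘ ∙-cancelʳ-⊏ (q ^ suc n)) sqⁿ⊏t)

  -- The ratio q is chosen with q^(1+n) < t/s; a start below s and a bound on the number of steps
  -- come from the powers of q being unbounded.
  dense : ∀ n {s t} → s ⊏ t → ∃[ w ] s ⊏ w ^ suc n × w ^ suc n ⊏ t
  dense n {s} {t} s⊏t =
    case small-root (suc n) (subst (_⊏ t ∙ s ⁻) (inverseʳ s) (∙-monoˡ-⊏ (s ⁻) s⊏t)) of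
      λ (q , ε⊏q , qⁿ⊏t/s) →
    case power-below n s ε⊏q of λ (w , wⁿ⊏s) →
    case power-above n w s ε⊏q of λ (j , s⊏) →
    climb n
      (subst₂ _⊏_ (comm _ _) (solve (s ∷ t ∷ []) (Y · X ⁻¹ · X) Y refl) (∙-monoˡ-⊏ s qⁿ⊏t/s))
      j w (⊏-asym wⁿ⊏s) s⊏

-- Cosets of k-th powers

module Cosets (F : PositiveFractions) where
  open FractionGroup F

  -- Prepares Euclid's argument in `fresh`: a prime divisor of 1 + M divides none of the numerators
  -- and denominators.
  common-multiple : ∀ cs → ∃[ M ] NonZero M × All (λ c → ∃[ a ] ∃[ b ] ∃[ a≢0 ] ∃[ b≢0 ]
                      c ∙ ι b {{b≢0}} ≡ ι a {{a≢0}} × a ∣ M × b ∣ M) cs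
  common-multiple []       = 1 , _ , []
  common-multiple (c ∷ cs) with fraction c | common-multiple cs
  ... | a , b , a≢0 , b≢0 , c∙b≡a | M , M≢0 , rest =
    a * b * M , ℕ.m*n≢0 (a * b) M {{ℕ.m*n≢0 a b {{a≢0}} {{b≢0}}}} {{M≢0}} ,
    (a , b , a≢0 , b≢0 , c∙b≡a , ∣m⇒∣m*n M (m∣m*n b) , ∣m⇒∣m*n M (n∣m*n a)) ∷
    All.map (λ (a′ , b′ , a′≢0 , b′≢0 , eq , a∣M , b∣M) →
      a′ , b′ , a′≢0 , b′≢0 , eq , ∣n⇒∣m*n (a * b) a∣M , ∣n⇒∣m*n (a * b) b∣M) rest

  -- As p divides neither a nor b, the p-adic valuation of p^K c is K, while that of a k-th power is
  -- a multiple of k.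
  prime-power-coset : ∀ {p c a b} (p-prime : Prime p) .{{_ : NonZero a}} .{{_ : NonZero b}} →
                      c ∙ ι b ≡ ι a → p ∤ a → p ∤ b →
                      ∀ K k → IsPow k (ι p {{prime⇒nonZero p-prime}} ^ K ∙ c) → k ∣ K
  prime-power-coset {p} {c} {a} {b} p-prime c∙b≡a p∤a p∤b K k (root y eq) with fraction y
  ... | e , f , e≢0 , f≢0 , y∙f≡e = valuation-∣ p-prime K k p∤a p∤b (ι-injective (begin
    ι (p ℕ.^ K * a * f ℕ.^ k)           ≡⟨ ι-* (p ℕ.^ K * a) (f ℕ.^ k) ⟩
    ι (p ℕ.^ K * a) ∙ ι (f ℕ.^ k)       ≡⟨ cong₂ _∙_ (ι-* (p ℕ.^ K) a) (ι-^ f k) ⟩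
    ι (p ℕ.^ K) ∙ ι a ∙ ι f ^ k         ≡⟨ cong₂ (λ u v → u ∙ v ∙ ι f ^ k) (ι-^ p K) (sym c∙b≡a) ⟩
    ι p ^ K ∙ (c ∙ ι b) ∙ ι f ^ k       ≡⟨ solve (ι p ^ K ∷ c ∷ ι b ∷ ι f ^ k ∷ [])
                                             (X · (Y · Z) · W) (X · Y · W · Z) refl ⟩
    ι p ^ K ∙ c ∙ ι f ^ k ∙ ι b         ≡⟨ cong (λ z → z ∙ ι f ^ k ∙ ι b) eq ⟩
    y ^ k ∙ ι f ^ k ∙ ι b               ≡⟨ cong (_∙ ι b) (^-∙ y (ι f) k) ⟨
    (y ∙ ι f) ^ k ∙ ι b                 ≡⟨ cong (λ z → z ^ k ∙ ι b) y∙f≡e ⟩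
    ι e ^ k ∙ ι b                       ≡⟨ cong (_∙ ι b) (ι-^ e k) ⟨
    ι (e ℕ.^ k) ∙ ι b                   ≡⟨ ι-* (e ℕ.^ k) b ⟨
    ι (e ℕ.^ k * b)                     ∎))
    where
    open ≡-Reasoning
    instance
      _ = e≢0
      _ = f≢0
      p≢0 : NonZero p
      p≢0 = prime⇒nonZero p-prime
      pᴷ≢0 : NonZero (p ℕ.^ K)
      pᴷ≢0 = ℕ.m^n≢0 p K
      fᵏ≢0 : NonZero (f ℕ.^ k)
      fᵏ≢0 = ℕ.m^n≢0 f k
      eᵏ≢0 : NonZero (e ℕ.^ k)
      eᵏ≢0 = ℕ.m^n≢0 e k
      pᴷa≢0 : NonZero (p ℕ.^ K * a)
      pᴷa≢0 = ℕ.m*n≢0 (p ℕ.^ K) a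
      lhs≢0 : NonZero (p ℕ.^ K * a * f ℕ.^ k)
      lhs≢0 = ℕ.m*n≢0 (p ℕ.^ K * a) (f ℕ.^ k)
      rhs≢0 : NonZero (e ℕ.^ k * b)
      rhs≢0 = ℕ.m*n≢0 (e ℕ.^ k) b

  -- Take a prime dividing no numerator and no denominator.
  fresh : ∀ cs → ∃[ w ] All (λ c → ∀ K k → IsPow k (w ^ K ∙ c) → k ∣ K) cs
  fresh cs with common-multiple cs
  ... | M , M≢0 , divisors with prime-divisor (suc M) (ℕ.s<s (ℕ.>-nonZero⁻¹ M {{M≢0}}))
  ...   | p , p-prime , p∣1+M = ι p {{prime⇒nonZero p-prime}} ,
    All.map (λ (a , b , a≢0 , b≢0 , eq , a∣M , b∣M) →
      prime-power-coset p-prime {{a≢0}} {{b≢0}} eq (∤ a∣M) (∤ b∣M)) divisors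
    where
    ∤ : ∀ {d} → d ∣ M → p ∤ d
    ∤ d∣M p∣d = >⇒∤ (ℕ.nonTrivial⇒n>1 p {{prime⇒nonTrivial p-prime}})
      (∣m+n∣m⇒∣n (subst (p ∣_) (ℕ.+-comm 1 M) p∣1+M) (∣-trans p∣d d∣M))

  -- Write w as w^(α m) / w^(β n). Inserting w = b^(n g) in the numerator and w = a^(m g) in the
  -- denominator turns both into (m n g)-th powers.
  merge-coprime : ∀ {m n} α β → α * m ≡ 1 + β * n → ∀ g w →
                  (IsPow (m * g) w × IsPow (n * g) w) ⇔ IsPow (m * n * g) w
  merge-coprime {m} {n} α β αm≡1+βn g w = mk⇔
    (λ (root a w≡aᵐᵍ , root b w≡bⁿᵍ) → root (b ^ α ∙ (a ^ β) ⁻) (begin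
      w                                                  ≡⟨ solve (w ∷ w ^ (β * n) ∷ []) X (X · Y · Y ⁻¹) refl ⟩
      w ^ (1 + β * n) ∙ (w ^ (β * n)) ⁻                  ≡⟨ cong (λ i → w ^ i ∙ (w ^ (β * n)) ⁻) αm≡1+βn ⟨
      w ^ (α * m) ∙ (w ^ (β * n)) ⁻                      ≡⟨ cong₂ (λ x y → x ^ (α * m) ∙ (y ^ (β * n)) ⁻) w≡bⁿᵍ w≡aᵐᵍ ⟩
      b ^ (n * g) ^ (α * m) ∙ (a ^ (m * g) ^ (β * n)) ⁻  ≡⟨ cong₂ (λ x y → x ∙ y ⁻)
                                                              (regroup b (n * g) (α * m) α (m * n * g) (lemma₁ n g α m))
                                                              (regroup a (m * g) (β * n) β (m * n * g) (lemma₂ m g β n)) ⟩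
      b ^ α ^ (m * n * g) ∙ (a ^ β ^ (m * n * g)) ⁻      ≡⟨ cong (b ^ α ^ (m * n * g) ∙_) (^-⁻ (a ^ β) (m * n * g)) ⟨
      b ^ α ^ (m * n * g) ∙ (a ^ β) ⁻ ^ (m * n * g)      ≡⟨ ^-∙ (b ^ α) ((a ^ β) ⁻) (m * n * g) ⟨
      (b ^ α ∙ (a ^ β) ⁻) ^ (m * n * g)                  ∎))
    (λ p → IsPow-∣ (divides n (lemma₃ m n g)) p , IsPow-∣ (divides m (ℕ.*-assoc m n g)) p)
    where
    open ≡-Reasoning
    regroup : ∀ x i j i′ j′ → j * i ≡ j′ * i′ → x ^ i ^ j ≡ x ^ i′ ^ j′
    regroup x i j i′ j′ eq = trans (^-^ x i j) (trans (cong (x ^_) eq) (sym (^-^ x i′ j′)))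
    lemma₁ : ∀ n g α m → α * m * (n * g) ≡ m * n * g * α
    lemma₁ = solve-∀
    lemma₂ : ∀ m g β n → β * n * (m * g) ≡ m * n * g * β
    lemma₂ = solve-∀
    lemma₃ : ∀ m n g → m * n * g ≡ n * (m * g)
    lemma₃ = solve-∀

  -- If v u⁻ is a g-th power, then z = u (v u⁻)^(α m) differs from u by an
  -- (m g)-th power and, since α m = 1 + β n, from v by an (n g)-th power.
  merge : ∀ {m n} α β → α * m ≡ 1 + β * n → ∀ g u v y →
          (IsPow (m * g) (y ∙ u) × IsPow (n * g) (y ∙ v)) ⇔
          (IsPow g (u ∙ v ⁻) × IsPow (m * n * g) (y ∙ (u ∙ (v ∙ u ⁻) ^ (α * m))))
  merge {m} {n} α β αm≡1+βn g u v y = mk⇔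
    (λ (pu , pv) → let pg = quotient pu pv in
      pg , to₃ (to (shift-u pg) pu , to (shift-v pg) pv))
    (λ (pg , pz) → from (shift-u pg) (proj₁ (from₃ pz)) , from (shift-v pg) (proj₂ (from₃ pz)))
    where
    open Equivalence
    z = u ∙ (v ∙ u ⁻) ^ (α * m)
    to₃ = to (merge-coprime {m} {n} α β αm≡1+βn g (y ∙ z))
    from₃ = from (merge-coprime {m} {n} α β αm≡1+βn g (y ∙ z))
    quotient : IsPow (m * g) (y ∙ u) → IsPow (n * g) (y ∙ v) → IsPow g (u ∙ v ⁻)
    quotient pu pv = subst (IsPow g) (solve (y ∷ u ∷ v ∷ []) (X · Y · (X · Z) ⁻¹) (Y · Z ⁻¹) refl)
      (IsPow-∙ g (IsPow-*ʳ {m} {g} pu) (IsPow-⁻ g (IsPow-*ʳ {n} {g} pv)))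
    inverse : IsPow g (u ∙ v ⁻) → IsPow g (v ∙ u ⁻)
    inverse pg = subst (IsPow g) (solve (u ∷ v ∷ []) ((X · Y ⁻¹) ⁻¹) (Y · X ⁻¹) refl) (IsPow-⁻ g pg)
    power : ∀ i j x → IsPow g x → IsPow (j * g) (x ^ (i * j))
    power i j _ (root a refl) =
      root (a ^ i) (trans (^-^ a g (i * j)) (trans (cong (a ^_) (lemma i j g)) (sym (^-^ a i (j * g)))))
      where
      lemma : ∀ i j g → i * j * g ≡ j * g * i
      lemma = solve-∀
    shift-u : IsPow g (u ∙ v ⁻) → IsPow (m * g) (y ∙ u) ⇔ IsPow (m * g) (y ∙ z)
    shift-u pg = IsPow-shift (m * g) (power α m _ (inverse pg)) (assoc _ _ _)
    shift-v : IsPow g (u ∙ v ⁻) → IsPow (n * g) (y ∙ v) ⇔ IsPow (n * g) (y ∙ z)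
    shift-v pg = IsPow-shift (n * g) (power β n _ (inverse pg)) (begin
      y ∙ v ∙ (v ∙ u ⁻) ^ (β * n)            ≡⟨ solve (y ∷ v ∷ u ∷ (v ∙ u ⁻) ^ (β * n) ∷ [])
                                                  (X · Y · W) (X · (Z · ((Y · Z ⁻¹) · W))) refl ⟩
      y ∙ (u ∙ (v ∙ u ⁻) ^ (1 + β * n))      ≡⟨ cong (λ i → y ∙ (u ∙ (v ∙ u ⁻) ^ i)) αm≡1+βn ⟨
      y ∙ z                                  ∎)
      where open ≡-Reasoning

-- Nonemptiness of cells

module Cells (F : PositiveFractions) where
  open FractionGroup F
  open Powers F
  open Cosets F

  ε⊏ι2 : ε ⊏ ι 2
  ε⊏ι2 = subst (_⊏ ι 2) ι-1 (ι-mono-⊏ (ℕ.n<1+n 1))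

  larger : ∀ x → ∃[ y ] x ⊏ y
  larger x = ι 2 ∙ x , subst (_⊏ ι 2 ∙ x) (identityˡ x) (∙-monoˡ-⊏ x ε⊏ι2)

  smaller : ∀ x → ∃[ y ] y ⊏ x
  smaller x = x ∙ ι 2 ⁻ , subst₂ _⊏_ (identityˡ _) (solve (x ∷ ι 2 ∷ []) (Y · (X · Y ⁻¹)) X refl)
    (∙-monoˡ-⊏ (x ∙ ι 2 ⁻) ε⊏ι2)

  module _ {A : Set} (f : A → Carrier) where
    -- This and the next two lemmas reduce the bounds on y to a single interval, also when a list of
    -- bounds is empty: c lies below all upper bounds, a is the maximum of c and the lower bounds,
    -- and b the minimum of the upper bounds and some element above a.
    strict-lower-bound : ∀ xs → ∃[ c ] All (λ x → c ⊏ f x) xs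
    strict-lower-bound []       = ε , []
    strict-lower-bound (x ∷ xs) with strict-lower-bound xs | smaller (f x)
    ... | c , c⊏xs | d , d⊏x with c ⊏? d
    ...   | yes c⊏d = c , ⊏-trans c⊏d d⊏x ∷ c⊏xs
    ...   | no  d⊑c = d , d⊏x ∷ All.map (⊑-⊏-trans d⊑c) c⊏xs

    interpolate : ∀ {c} xs → All (λ x → c ⊏ f x) xs → ∃[ d ] c ⊏ d × All (λ x → d ⊑ f x) xs
    interpolate {c} []       []            = proj₁ (larger c) , proj₂ (larger c) , []
    interpolate     (x ∷ xs) (c⊏x ∷ c⊏xs) with interpolate xs c⊏xs
    ... | d , c⊏d , d⊑xs with f x ⊏? d
    ...   | yes x⊏d = f x , c⊏x , ⊏-irrefl ∷ All.map (⊑-trans (⊏-asym x⊏d)) d⊑xs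
    ...   | no  d⊑x = d , c⊏d , d⊑x ∷ d⊑xs

    upper-bound : ∀ {P : Carrier → Set} {c} xs → P c → All (P ∘ f) xs →
                  ∃[ d ] P d × All (λ x → f x ⊑ d) xs
    upper-bound {c = c} [] Pc [] = c , Pc , []
    upper-bound (x ∷ xs) Pc (Px ∷ Pxs) with upper-bound xs Pc Pxs
    ... | d , Pd , xs⊑d with f x ⊏? d
    ...   | yes x⊏d = d , Pd , ⊏-asym x⊏d ∷ xs⊑d
    ...   | no  d⊑x = f x , Px , ⊏-irrefl ∷ All.map (λ y⊑d → ⊑-trans y⊑d d⊑x) xs⊑d

  common-exponent : ∀ {A : Set} (k : A → ℕ) xs → ∃[ N ] All (λ x → suc (k x) ∣ suc N) xs
  common-exponent k []       = 0 , []
  common-exponent k (x ∷ xs) with common-exponent k xs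
  -- Its successor computes to `suc (k x) * suc N`; products of exponents are encoded in the same
  -- way in `scale` and `uniform`.
  ... | N , divs = N + k x * suc N ,
    m∣m*n (suc N) ∷ All.map (∣n⇒∣m*n (suc (k x))) divs

  -- The conditions met by y in the elimination of ∃ y: bounds, a coset of the
  -- (1+K)-th powers, and finitely many cosets to be avoided. Exponents are
  -- stored as predecessors.
  record Cell {n} (ls us : List (Term n)) (K : ℕ) (u : Term n) (ns : List (ℕ × Term n))
              (y : Carrier) (ρ : Vec Carrier n) : Set where
    constructor cell
    field
      lower : All (λ l → ⟪ l ⟫ ρ ⊏ y) ls
      upper : All (λ t → y ⊏ ⟪ t ⟫ ρ) us
      coset : IsPow (suc K) (y ∙ ⟪ u ⟫ ρ)
      avoid : All (λ (k , v) → ¬ IsPow (suc k) (y ∙ ⟪ v ⟫ ρ)) ns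

  module _ {n} (ls us : List (Term n)) (K : ℕ) (u : Term n) (ns : List (ℕ × Term n))
           (ρ : Vec Carrier n) where
    -- If k-th powers include the K-th powers, then for y u a K-th power, y v is a k-th power
    -- exactly if v u⁻¹ is; hence a condition on ρ alone.
    NonEmpty : Set
    NonEmpty = All (λ l → All (λ t → ⟪ l ⟫ ρ ⊏ ⟪ t ⟫ ρ) us) ls ×
               All (λ (k , v) → suc k ∣ suc K → ¬ IsPow (suc k) (⟪ v · u ⁻¹ ⟫ ρ)) ns

    cell⇒nonEmpty : ∃[ y ] Cell ls us K u ns y ρ → NonEmpty
    cell⇒nonEmpty (y , cell lower upper coset avoid) =
      All.map (λ l⊏y → All.map (⊏-trans l⊏y) upper) lower ,
      All.map (λ {kv} ¬pow k∣K pow → ¬pow (subst (IsPow (suc (proj₁ kv)))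
        (solve (y ∷ ⟪ u ⟫ ρ ∷ ⟪ proj₂ kv ⟫ ρ ∷ []) (X · Y · (Z · Y ⁻¹)) (X · Z) refl)
        (IsPow-∙ (suc (proj₁ kv)) (IsPow-∣ k∣K coset) pow))) avoid

    -- The cosets with k ∤ K are avoided by a fresh w, those with k ∣ K by
    -- assumption; the order constraints by density of the N-th powers, where N
    -- is a multiple of all exponents.
    nonEmpty⇒cell : NonEmpty → ∃[ y ] Cell ls us K u ns y ρ
    nonEmpty⇒cell (ls⊏us , avoid) =
      case strict-lower-bound ⟪_⟫ρ us of λ (c , c⊏us) →
      case upper-bound ⟪_⟫ρ {λ d → All (λ t → d ⊏ ⟪ t ⟫ρ) us} ls c⊏us ls⊏us of λ (a , a⊏us , ls⊑a) →
      case interpolate ⟪_⟫ρ us a⊏us of λ (b , a⊏b , b⊑us) →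
      case fresh (map quotient ns) of λ (w , w-fresh) →
      case common-exponent {ℕ × Term n} proj₁ ((K , u) ∷ ns) of λ { (N , K∣N ∷ ns∣N) →
      let y₀ = (⟪ u ⟫ρ) ⁻ ∙ w ^ suc K in
      case dense N (∙-monoˡ-⊏ (y₀ ⁻) a⊏b) of λ (z , a⊏z , z⊏b) →
      let y      = z ^ suc N ∙ y₀
          cancel = λ x → solve (x ∷ y₀ ∷ []) (X · Y ⁻¹ · Y) X refl
          a⊏y    = subst (_⊏ y) (cancel a) (∙-monoˡ-⊏ y₀ a⊏z)
          y⊏b    = subst (y ⊏_) (cancel b) (∙-monoˡ-⊏ y₀ z⊏b)
          zᴺ     = IsPow-^ (suc N) z
      in
      y , cell
        (All.map (λ l⊑a → ⊑-⊏-trans l⊑a a⊏y) ls⊑a)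
        (All.map (⊏-⊑-trans y⊏b) b⊑us)
        (subst (IsPow (suc K))
          (solve (z ^ suc N ∷ w ^ suc K ∷ ⟪ u ⟫ρ ∷ []) (X · Y) (X · (Z ⁻¹ · Y) · Z) refl)
          (IsPow-∙ (suc K) (IsPow-∣ K∣N zᴺ) (IsPow-^ (suc K) w)))
        (All.zipWith (λ {(k , v)} ((¬pow , fr) , k∣N) pow →
          let powᵥ = Equivalence.from (IsPow-shift (suc k) {⟪ v · u ⁻¹ ⟫ ρ ∙ w ^ suc K} (IsPow-∣ k∣N zᴺ)
                (solve (⟪ v ⟫ρ ∷ ⟪ u ⟫ρ ∷ w ^ suc K ∷ z ^ suc N ∷ [])
                  (X · Y ⁻¹ · Z · W) (W · (Y ⁻¹ · Z) · X) refl)) pow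
              k∣K = fr (suc K) (suc k) (subst (IsPow (suc k)) (comm _ _) powᵥ)
          in ¬pow k∣K (Equivalence.from (IsPow-shift (suc k) (IsPow-∣ k∣K (IsPow-^ (suc K) w)) refl) powᵥ))
          (All.zip (avoid , All.map⁻ w-fresh) , ns∣N))
      }
      where
      ⟪_⟫ρ : Term n → Carrier
      ⟪ t ⟫ρ = ⟪ t ⟫ ρ
      quotient : ℕ × Term n → Carrier
      quotient (k , v) = ⟪ v · u ⁻¹ ⟫ ρ

-- Definable predicates and elimination of quantifiers

module Elimination (F : PositiveFractions) where
  open FractionGroup F
  open Powers F
  open Cosets F
  open Cells F
  open Equivalence using (to; from)

  infix 0 _⊩_
  _⊩_ : ∀ {n} → Vec Carrier n → Formula n → Set
  ρ ⊩ s ≐ t = ⟪ s ⟫ ρ ≡ ⟪ t ⟫ ρ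
  ρ ⊩ s ≺ t = ⟪ s ⟫ ρ ⊏ ⟪ t ⟫ ρ
  ρ ⊩ R k t = IsPow k (⟪ t ⟫ ρ)
  ρ ⊩ ~ φ   = ¬ (ρ ⊩ φ)
  ρ ⊩ φ ∧ ψ = (ρ ⊩ φ) × (ρ ⊩ ψ)
  ρ ⊩ φ ∨ ψ = (ρ ⊩ φ) ⊎ (ρ ⊩ ψ)
  ρ ⊩ φ ⇒ ψ = (ρ ⊩ φ) → (ρ ⊩ ψ)
  ρ ⊩ all φ = ∀ x → x ∷ ρ ⊩ φ
  ρ ⊩ ex φ  = ∃[ x ] (x ∷ ρ ⊩ φ)

  -- Takes the place of excluded middle where implications become disjunctions and ∀ becomes ¬ ∃ ¬.
  quantifierFree? : ∀ {n} {φ : Formula n} → QuantifierFree φ → ∀ ρ → Dec (ρ ⊩ φ)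
  quantifierFree? (s ≐ t) ρ       = ⟪ s ⟫ ρ ≟ ⟪ t ⟫ ρ
  quantifierFree? (s ≺ t) ρ       = ⟪ s ⟫ ρ ⊏? ⟪ t ⟫ ρ
  quantifierFree? (R (suc k) t) ρ = IsPow? k (⟪ t ⟫ ρ)
  quantifierFree? (~ p) ρ         = Dec.¬? (quantifierFree? p ρ)
  quantifierFree? (p ∧ q) ρ       = quantifierFree? p ρ Dec.×-dec quantifierFree? q ρ
  quantifierFree? (p ∨ q) ρ       = quantifierFree? p ρ Dec.⊎-dec quantifierFree? q ρ
  quantifierFree? (p ⇒ q) ρ       = quantifierFree? p ρ Dec.→-dec quantifierFree? q ρ

  -- A property of predicates rather than of formulas: it is transported along equivalences, and the
  -- eliminating formula is assembled without ever being written out.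
  Definable : ∀ {n} → (Vec Carrier n → Set) → Set
  Definable P = ∃[ ψ ] QuantifierFree ψ × (∀ ρ → P ρ ⇔ (ρ ⊩ ψ))

  module _ {n} {P Q : Vec Carrier n → Set} where
    definable-resp : (∀ ρ → P ρ ⇔ Q ρ) → Definable Q → Definable P
    definable-resp P⇔Q (ψ , qf , Q⇔ψ) = ψ , qf , λ ρ → ⇔.trans (P⇔Q ρ) (Q⇔ψ ρ)

    definable-∧ : Definable P → Definable Q → Definable (λ ρ → P ρ × Q ρ)
    definable-∧ (φ , p , P⇔φ) (ψ , q , Q⇔ψ) = (φ ∧ ψ) , (p ∧ q) , λ ρ → P⇔φ ρ ×-⇔ Q⇔ψ ρ

    definable-∨ : Definable P → Definable Q → Definable (λ ρ → P ρ ⊎ Q ρ)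
    definable-∨ (φ , p , P⇔φ) (ψ , q , Q⇔ψ) = (φ ∨ ψ) , (p ∨ q) , λ ρ → P⇔φ ρ ⊎-⇔ Q⇔ψ ρ

    definable-⇒ : Definable P → Definable Q → Definable (λ ρ → P ρ → Q ρ)
    definable-⇒ (φ , p , P⇔φ) (ψ , q , Q⇔ψ) = (φ ⇒ ψ) , (p ⇒ q) , λ ρ → →-cong-⇔ (P⇔φ ρ) (Q⇔ψ ρ)

  definable-¬ : ∀ {n} {P : Vec Carrier n → Set} → Definable P → Definable (λ ρ → ¬ P ρ)
  definable-¬ (φ , p , P⇔φ) = (~ φ) , (~ p) , λ ρ → ¬-cong-⇔ (P⇔φ ρ)

  definable-⊤ : ∀ {n} {P : Vec Carrier n → Set} → (∀ ρ → P ρ) → Definable P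
  definable-⊤ p = 𝟏 ≐ 𝟏 , 𝟏 ≐ 𝟏 , λ ρ → mk⇔ (λ _ → refl) (λ _ → p ρ)

  definable-⊥ : ∀ {n} {P : Vec Carrier n → Set} → (∀ ρ → ¬ P ρ) → Definable P
  definable-⊥ ¬p = (~ 𝟏 ≐ 𝟏) , (~ (𝟏 ≐ 𝟏)) , λ ρ → mk⇔ (λ p _ → ¬p ρ p) (λ ε≢ε → contradiction refl ε≢ε)

  module _ {n} {A : Set} {P : A → Vec Carrier n → Set} (defP : ∀ a → Definable (P a)) where
    definable-All : ∀ as → Definable (λ ρ → All (λ a → P a ρ) as)
    definable-All []       = definable-⊤ λ _ → []
    definable-All (a ∷ as) = definable-resp (λ ρ → mk⇔ All.uncons (λ (p , ps) → p ∷ ps))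
      (definable-∧ (defP a) (definable-All as))

    definable-Any : ∀ as → Definable (λ ρ → Any (λ a → P a ρ) as)
    definable-Any []       = definable-⊥ λ _ ()
    definable-Any (a ∷ as) = definable-resp (λ ρ → mk⇔ Any.toSum Any.fromSum)
      (definable-∨ (defP a) (definable-Any as))

  definable-quantifierFree : ∀ {n} (ψ : Formula n) → QuantifierFree ψ → Definable (λ ρ → ρ ⊩ ψ)
  definable-quantifierFree ψ qf = ψ , qf , λ ρ → mk⇔ id id

  definable-≐ : ∀ {n} (s t : Term n) → Definable (λ ρ → ⟪ s ⟫ ρ ≡ ⟪ t ⟫ ρ)
  definable-≐ s t = s ≐ t , s ≐ t , λ ρ → ⇔-id _

  definable-≺ : ∀ {n} (s t : Term n) → Definable (λ ρ → ⟪ s ⟫ ρ ⊏ ⟪ t ⟫ ρ)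
  definable-≺ s t = s ≺ t , s ≺ t , λ ρ → ⇔-id _

  definable-pow : ∀ {n} k (t : Term n) → Definable (λ ρ → IsPow (suc k) (⟪ t ⟫ ρ))
  -- The language has no R₁, but every element is a first power.
  definable-pow zero    t = definable-⊤ λ ρ → root (⟪ t ⟫ ρ) (sym (identityʳ _))
  definable-pow (suc k) t = R (suc (suc k)) t , R (suc (suc k)) t , λ ρ → ⇔-id _

  -- Conjunctions of literals in one variable

  powᵗ : ∀ {n} → Term n → ℕ → Term n
  powᵗ t zero    = 𝟏
  powᵗ t (suc k) = t · powᵗ t k

  powᵗ-^ : ∀ {n} (t : Term n) k ρ → ⟪ powᵗ t k ⟫ ρ ≡ ⟪ t ⟫ ρ ^ k
  powᵗ-^ t zero    ρ = refl
  powᵗ-^ t (suc k) ρ = cong (⟪ t ⟫ ρ ∙_) (powᵗ-^ t k ρ)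

  -- Literals in a distinguished variable y, which occurs with exponent one;
  -- the indices of pow and npow are predecessors of the exponents.
  data Lit (n : ℕ) : Set where
    eq lt gt : Term n → Lit n
    pow npow : ℕ → Term n → Lit n
    par      : (ψ : Formula n) → QuantifierFree ψ → Lit n

  Sat : ∀ {n} → Carrier → Vec Carrier n → Lit n → Set
  Sat y ρ (eq u)     = y ≡ ⟪ u ⟫ ρ
  Sat y ρ (lt u)     = y ⊏ ⟪ u ⟫ ρ
  Sat y ρ (gt u)     = ⟪ u ⟫ ρ ⊏ y
  Sat y ρ (pow k u)  = IsPow (suc k) (y ∙ ⟪ u ⟫ ρ)
  Sat y ρ (npow k u) = ¬ IsPow (suc k) (y ∙ ⟪ u ⟫ ρ)
  Sat y ρ (par ψ _)  = ρ ⊩ ψ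

  definable-Sat : ∀ {n} (t : Term n) l → Definable (λ ρ → Sat (⟪ t ⟫ ρ) ρ l)
  definable-Sat t (eq u)     = definable-≐ t u
  definable-Sat t (lt u)     = definable-≺ t u
  definable-Sat t (gt u)     = definable-≺ u t
  definable-Sat t (pow k u)  = definable-pow k (t · u)
  definable-Sat t (npow k u) = definable-¬ (definable-pow k (t · u))
  definable-Sat t (par ψ qf) = definable-quantifierFree ψ qf

  scale : ∀ {n} → ℕ → Lit n → Lit n
  scale d (eq u)     = eq (powᵗ u (suc d))
  scale d (lt u)     = lt (powᵗ u (suc d))
  scale d (gt u)     = gt (powᵗ u (suc d))
  scale d (pow k u)  = pow (k + d * suc k) (powᵗ u (suc d))
  scale d (npow k u) = npow (k + d * suc k) (powᵗ u (suc d))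
  scale d (par ψ qf) = par ψ qf

  -- Taking (1+d)-th powers is injective and strictly monotone, and by `IsPow-scale` it multiplies
  -- the exponents of power conditions; so no literal loses information.
  scale-⇔ : ∀ {n} d y (ρ : Vec Carrier n) l → Sat y ρ l ⇔ Sat (y ^ suc d) ρ (scale d l)
  scale-⇔ d y ρ l = subst-⇔ l
    where
    subst-pow : ∀ k u → IsPow (suc k) (y ∙ ⟪ u ⟫ ρ) ⇔
                IsPow (suc d * suc k) (y ^ suc d ∙ ⟪ powᵗ u (suc d) ⟫ ρ)
    subst-pow k u rewrite powᵗ-^ u d ρ = subst
      (λ z → IsPow (suc k) (y ∙ ⟪ u ⟫ ρ) ⇔ IsPow (suc d * suc k) z)
      (^-∙ y (⟪ u ⟫ ρ) (suc d)) (IsPow-scale d (suc k) (y ∙ ⟪ u ⟫ ρ))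
    subst-⇔ : ∀ l → Sat y ρ l ⇔ Sat (y ^ suc d) ρ (scale d l)
    subst-⇔ (eq u) rewrite powᵗ-^ u d ρ = mk⇔ (cong (_^ suc d)) (^-injective d)
    subst-⇔ (lt u) rewrite powᵗ-^ u d ρ = mk⇔ (^-monoˡ-⊏ d) (^-cancelˡ-⊏ (suc d))
    subst-⇔ (gt u) rewrite powᵗ-^ u d ρ = mk⇔ (^-monoˡ-⊏ d) (^-cancelˡ-⊏ (suc d))
    subst-⇔ (pow k u)  = subst-pow k u
    subst-⇔ (npow k u) = ¬-cong-⇔ (subst-pow k u)
    subst-⇔ (par ψ _)  = ⇔-id _

  -- (e , l) is the literal l with y = x¹⁺ᵉ.
  XLit : ℕ → Set
  XLit n = ℕ × Lit n

  XSat : ∀ {n} → Carrier → Vec Carrier n → XLit n → Set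
  XSat x ρ (e , l) = Sat (x ^ suc e) ρ l

  scale-^-⇔ : ∀ {n} d e x (ρ : Vec Carrier n) l →
              Sat (x ^ suc e) ρ l ⇔ Sat (x ^ (suc d * suc e)) ρ (scale d l)
  scale-^-⇔ d e x ρ l = subst (λ z → Sat (x ^ suc e) ρ l ⇔ Sat z ρ (scale d l)) (^-^ x (suc e) (suc d))
    (scale-⇔ d (x ^ suc e) ρ l)

  uniform : ∀ {n} (c : List (XLit n)) → ∃[ m ] ∃[ c′ ] ∀ x ρ →
            All (XSat x ρ) c ⇔ All (Sat (x ^ suc m) ρ) c′
  uniform []            = 0 , [] , λ x ρ → mk⇔ (λ _ → []) (λ _ → [])
  uniform ((e , l) ∷ c) with uniform c
  -- The common exponent is the product `suc e * suc m`: the new literal is raised to `suc m`, the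
  -- earlier ones to `suc e`.
  ... | m , c′ , c⇔c′ = m + e * suc m , scale m l ∷ map (scale e) c′ , λ x ρ → mk⇔
    (λ { (s ∷ ss) →
      subst (λ i → Sat (x ^ i) ρ (scale m l)) (ℕ.*-comm (suc m) (suc e)) (to (scale-^-⇔ m e x ρ l) s)
      ∷ All.map⁺ (All.map (λ {l} → to (scale-^-⇔ e m x ρ l)) (to (c⇔c′ x ρ) ss)) })
    (λ { (s ∷ ss) →
      from (scale-^-⇔ m e x ρ l)
        (subst (λ i → Sat (x ^ i) ρ (scale m l)) (ℕ.*-comm (suc e) (suc m)) s)
      ∷ from (c⇔c′ x ρ) (All.map (λ {l} → from (scale-^-⇔ e m x ρ l)) (All.map⁻ ss)) })

  -- The form of `merge` on terms: exponents and representatives are chosen before ρ and y, so the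
  -- replacement takes place inside formulas.
  MergedCosets : ∀ {n} → ℕ → Term n → ℕ → Term n → Set
  MergedCosets K u k v = ∃[ g ] ∃[ s ] ∃[ L ] ∃[ z ] ∀ ρ y →
    (IsPow (suc K) (y ∙ ⟪ u ⟫ ρ) × IsPow (suc k) (y ∙ ⟪ v ⟫ ρ)) ⇔
    (IsPow (suc g) (⟪ s ⟫ ρ) × IsPow (suc L) (y ∙ ⟪ z ⟫ ρ))

  merge-bézout : ∀ {n} K (u : Term n) k v → BézoutIdentity (suc K) (suc k) → MergedCosets K u k v
  merge-bézout K u k v (bézoutIdentity zero m n α β m≡ n≡ αm≡1+βn) =
    contradiction (trans m≡ (ℕ.*-zeroʳ m)) λ ()
  merge-bézout K u k v (bézoutIdentity (suc g) (suc m) (suc n) α β refl refl αm≡1+βn) =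
    -- The exponent left to unification is the predecessor of `suc m * suc n * suc g`, the least
    -- common multiple of the two given exponents.
    g , u · v ⁻¹ , _ , u · powᵗ (v · u ⁻¹) (α * suc m) , λ ρ y →
      subst (λ z → _ ⇔ (_ × IsPow (suc m * suc n * suc g) (y ∙ (⟪ u ⟫ ρ ∙ z))))
        (sym (powᵗ-^ (v · u ⁻¹) (α * suc m) ρ))
        (merge {suc m} {suc n} α β αm≡1+βn (suc g) (⟪ u ⟫ ρ) (⟪ v ⟫ ρ) y)

  mergeCosets : ∀ {n} K (u : Term n) k v → MergedCosets K u k v
  mergeCosets K u k v with bézout (suc K) (suc k)
  ... | inj₁ id = merge-bézout K u k v id
  ... | inj₂ id with merge-bézout k v K u id
  ...   | g , s , L , z , merged = g , s , L , z , λ ρ y → ⇔.trans (mk⇔ swap swap) (merged ρ y)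

  -- Recursion on the pending literals `c`: bounds and power conditions are absorbed into the
  -- description of the cell, parameter conditions are split off, and an equation ends the
  -- recursion, since it determines y.
  definable-∃-cell : ∀ {n} ls us K (u : Term n) ns (c : List (Lit n)) →
                     Definable (λ ρ → ∃[ y ] Cell ls us K u ns y ρ × All (Sat y ρ) c)
  definable-∃-cell ls us K u ns [] = definable-resp
    (λ ρ → mk⇔ (λ { (y , y∈C , []) → cell⇒nonEmpty ls us K u ns ρ (y , y∈C) })
               (λ ne → case nonEmpty⇒cell ls us K u ns ρ ne of λ (y , y∈C) → y , y∈C , []))
    (definable-∧ (definable-All (λ l → definable-All (definable-≺ l) us) ls) (definable-All avoid ns))
    where
    avoid : ∀ kv → Definable (λ ρ →
            suc (proj₁ kv) ∣ suc K → ¬ IsPow (suc (proj₁ kv)) (⟪ proj₂ kv · u ⁻¹ ⟫ ρ))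
    avoid (k , v) with suc k ∣? suc K
    ... | yes k∣K = definable-resp (λ ρ → mk⇔ (λ f → f k∣K) (λ f _ → f))
      (definable-¬ (definable-pow k (v · u ⁻¹)))
    ... | no  k∤K = definable-⊤ λ ρ k∣K → contradiction k∣K k∤K
  definable-∃-cell ls us K u ns (eq t ∷ c) = definable-resp
    (λ ρ → mk⇔ (λ { (_ , cell lower upper coset avoid , refl ∷ s) → lower , upper , coset , avoid , s })
               (λ (lower , upper , coset , avoid , s) → _ , cell lower upper coset avoid , refl ∷ s))
    (definable-∧ (definable-All (λ l → definable-≺ l t) ls)
      (definable-∧ (definable-All (definable-≺ t) us)
        (definable-∧ (definable-pow K (t · u))
          (definable-∧ (definable-All (λ (k , v) → definable-¬ (definable-pow k (t · v))) ns)
            (definable-All (definable-Sat t) c)))))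
  definable-∃-cell ls us K u ns (lt t ∷ c) = definable-resp
    (λ ρ → mk⇔ (λ { (y , cell lower upper coset avoid , s ∷ ss) → y , cell lower (s ∷ upper) coset avoid , ss })
               (λ { (y , cell lower (s ∷ upper) coset avoid , ss) → y , cell lower upper coset avoid , s ∷ ss }))
    (definable-∃-cell ls (t ∷ us) K u ns c)
  definable-∃-cell ls us K u ns (gt t ∷ c) = definable-resp
    (λ ρ → mk⇔ (λ { (y , cell lower upper coset avoid , s ∷ ss) → y , cell (s ∷ lower) upper coset avoid , ss })
               (λ { (y , cell (s ∷ lower) upper coset avoid , ss) → y , cell lower upper coset avoid , s ∷ ss }))
    (definable-∃-cell (t ∷ ls) us K u ns c)
  definable-∃-cell ls us K u ns (pow k v ∷ c) with mergeCosets K u k v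
  ... | g , s , L , z , merged = definable-resp
    (λ ρ → mk⇔
      (λ { (y , cell lower upper coset avoid , p ∷ ss) → case to (merged ρ y) (coset , p) of
        λ (q , coset′) →
           q , y , cell lower upper coset′ avoid , ss })
      (λ { (q , y , cell lower upper coset′ avoid , ss) → case from (merged ρ y) (q , coset′) of
        λ (coset , p) →
           y , cell lower upper coset avoid , p ∷ ss }))
    (definable-∧ (definable-pow g s) (definable-∃-cell ls us L z ns c))
  definable-∃-cell ls us K u ns (npow k v ∷ c) = definable-resp
    (λ ρ → mk⇔ (λ { (y , cell lower upper coset avoid , s ∷ ss) → y , cell lower upper coset (s ∷ avoid) , ss })
               (λ { (y , cell lower upper coset (s ∷ avoid) , ss) → y , cell lower upper coset avoid , s ∷ ss }))
    (definable-∃-cell ls us K u ((k , v) ∷ ns) c)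
  definable-∃-cell ls us K u ns (par ψ qf ∷ c) = definable-resp
    (λ ρ → mk⇔ (λ { (y , y∈C , s ∷ ss) → s , y , y∈C , ss }) (λ (s , y , y∈C , ss) → y , y∈C , s ∷ ss))
    (definable-∧ (definable-quantifierFree ψ qf) (definable-∃-cell ls us K u ns c))

  definable-∃-All : ∀ {n} (c : List (XLit n)) → Definable (λ ρ → ∃[ x ] All (XSat x ρ) c)
  definable-∃-All c with uniform c
  ... | m , c′ , c⇔c′ = definable-resp
    (λ ρ → mk⇔
      (λ (x , s) → x ^ suc m , cell [] [] (root x (identityʳ _)) [] , to (c⇔c′ x ρ) s)
      (λ (y , cell _ _ (root x y∙ε≡xᵐ) _ , s) →
        x , from (c⇔c′ x ρ) (subst (λ y → All (Sat y ρ) c′) (trans (sym (identityʳ y)) y∙ε≡xᵐ) s)))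
    -- The initial coset says that y · 𝟏 is a (1+m)-th power, namely that of the x sought.
    (definable-∃-cell [] [] m 𝟏 [] c′)

  -- Disjunctive normal forms

  DNF : ∀ {n} → (Carrier → Vec Carrier n → Set) → Set
  DNF P = ∃[ D ] ∀ x ρ → P x ρ ⇔ Any (All (XSat x ρ)) D

  definable-∃ : ∀ {n} {P : Carrier → Vec Carrier n → Set} → DNF P → Definable (λ ρ → ∃[ x ] P x ρ)
  definable-∃ (D , P⇔D) = definable-resp
    (λ ρ → mk⇔ (λ (x , p) → Any.Any-Σ⁺ʳ (x , to (P⇔D x ρ) p))
               (λ q → case Any.Any-Σ⁻ʳ q of λ (x , d) → x , from (P⇔D x ρ) d))
    (definable-Any definable-∃-All D)

  module _ {n} {P Q : Carrier → Vec Carrier n → Set} where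
    dnf-resp : (∀ x ρ → P x ρ ⇔ Q x ρ) → DNF Q → DNF P
    dnf-resp P⇔Q (D , Q⇔D) = D , λ x ρ → ⇔.trans (P⇔Q x ρ) (Q⇔D x ρ)

    dnf-∨ : DNF P → DNF Q → DNF (λ x ρ → P x ρ ⊎ Q x ρ)
    dnf-∨ (D , P⇔D) (E , Q⇔E) = D ++ E , λ x ρ →
      ⇔.trans (P⇔D x ρ ⊎-⇔ Q⇔E x ρ) (mk⇔ [ Any.++⁺ˡ , Any.++⁺ʳ D ]′ (Any.++⁻ D))

  -- With `⏊̸`-style negations of the order treated likewise below, trichotomy makes negated
  -- comparisons positive; among literals in y only power conditions need a negated form.
  ≢-⇔ : ∀ {x y} → (¬ (x ≡ y)) ⇔ (x ⊏ y ⊎ y ⊏ x)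
  ≢-⇔ {x} {y} = mk⇔ to′ λ { (inj₁ x⊏y) refl → ⊏-irrefl x⊏y ; (inj₂ y⊏x) refl → ⊏-irrefl y⊏x }
    where
    to′ : ¬ (x ≡ y) → x ⊏ y ⊎ y ⊏ x
    to′ x≢y with compare x y
    ... | tri< x⊏y _ _ = inj₁ x⊏y
    ... | tri≈ _ x≡y _ = contradiction x≡y x≢y
    ... | tri> _ _ y⊏x = inj₂ y⊏x

  ⊏̸-⇔ : ∀ {x y} → (¬ (x ⊏ y)) ⇔ (x ≡ y ⊎ y ⊏ x)
  ⊏̸-⇔ {x} {y} = mk⇔ to′ λ { (inj₁ refl) → ⊏-irrefl ; (inj₂ y⊏x) → ⊏-asym y⊏x }
    where
    to′ : ¬ (x ⊏ y) → x ≡ y ⊎ y ⊏ x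
    to′ y⊑x with compare x y
    ... | tri< x⊏y _ _ = contradiction x⊏y y⊑x
    ... | tri≈ _ x≡y _ = inj₁ x≡y
    ... | tri> _ _ y⊏x = inj₂ y⊏x

  module _ {n : ℕ} where
    Conj : List (XLit n) → Carrier → Vec Carrier n → Set
    Conj c x ρ = All (XSat x ρ) c

    Disj : List (List (XLit n)) → Carrier → Vec Carrier n → Set
    Disj D x ρ = Any (All (XSat x ρ)) D

    dnf-⊥ : {P : Carrier → Vec Carrier n → Set} → (∀ x ρ → ¬ P x ρ) → DNF P
    dnf-⊥ ¬p = [] , λ x ρ → mk⇔ (λ p → contradiction p (¬p x ρ)) (λ ())

    dnf-⊤ : {P : Carrier → Vec Carrier n → Set} → (∀ x ρ → P x ρ) → DNF P
    dnf-⊤ p = [] ∷ [] , λ x ρ → mk⇔ (λ _ → here []) (λ _ → p x ρ)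

    dnf-literal : ∀ (l : XLit n) → DNF (λ x ρ → XSat x ρ l)
    dnf-literal l = (l ∷ []) ∷ [] , λ x ρ → mk⇔ (λ s → here (s ∷ [])) (λ { (here (s ∷ [])) → s })

    dnf-Conj-∧ : ∀ c D → DNF (λ x ρ → Conj c x ρ × Disj D x ρ)
    dnf-Conj-∧ c D = map (c ++_) D , λ x ρ → mk⇔
      (λ (s , d) → Any.map⁺ (Any.map (All.++⁺ s) d))
      (λ d → let d′ = Any.map (All.++⁻ c) (Any.map⁻ d) in proj₁ (proj₂ (Any.satisfied d′)) , Any.map proj₂ d′)

    dnf-Disj-∧ : ∀ D E → DNF (λ x ρ → Disj D x ρ × Disj E x ρ)
    dnf-Disj-∧ []      E = dnf-⊥ λ { x ρ (() , _) }
    dnf-Disj-∧ (c ∷ D) E = dnf-resp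
      (λ x ρ → mk⇔ (λ { (here s , e) → inj₁ (s , e) ; (there d , e) → inj₂ (d , e) })
                   (λ { (inj₁ (s , e)) → here s , e ; (inj₂ (d , e)) → there d , e }))
      (dnf-∨ (dnf-Conj-∧ c E) (dnf-Disj-∧ D E))

    dnf-∧ : {P Q : Carrier → Vec Carrier n → Set} → DNF P → DNF Q → DNF (λ x ρ → P x ρ × Q x ρ)
    dnf-∧ (D , P⇔D) (E , Q⇔E) = dnf-resp (λ x ρ → P⇔D x ρ ×-⇔ Q⇔E x ρ) (dnf-Disj-∧ D E)

    Sat? : ∀ y ρ (l : Lit n) → Dec (Sat y ρ l)
    Sat? y ρ (eq u)     = y ≟ ⟪ u ⟫ ρ
    Sat? y ρ (lt u)     = y ⊏? ⟪ u ⟫ ρ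
    Sat? y ρ (gt u)     = ⟪ u ⟫ ρ ⊏? y
    Sat? y ρ (pow k u)  = IsPow? k (y ∙ ⟪ u ⟫ ρ)
    Sat? y ρ (npow k u) = Dec.¬? (IsPow? k (y ∙ ⟪ u ⟫ ρ))
    Sat? y ρ (par ψ qf) = quantifierFree? qf ρ

    dnf-¬literal : ∀ (l : XLit n) → DNF (λ x ρ → ¬ XSat x ρ l)
    dnf-¬literal (e , eq u)     = dnf-resp (λ x ρ → ≢-⇔) (dnf-∨ (dnf-literal (e , lt u)) (dnf-literal (e , gt u)))
    dnf-¬literal (e , lt u)     = dnf-resp (λ x ρ → ⊏̸-⇔) (dnf-∨ (dnf-literal (e , eq u)) (dnf-literal (e , gt u)))
    dnf-¬literal (e , gt u)     = dnf-resp
      (λ x ρ → ⇔.trans ⊏̸-⇔ (mk⇔ sym sym ⊎-⇔ ⇔-id _)) (dnf-∨ (dnf-literal (e , eq u)) (dnf-literal (e , lt u)))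
    dnf-¬literal (e , pow k u)  = dnf-literal (e , npow k u)
    dnf-¬literal (e , npow k u) = dnf-resp
      (λ x ρ → mk⇔ (Dec.decidable-stable (IsPow? k _)) (λ p ¬p → ¬p p)) (dnf-literal (e , pow k u))
    dnf-¬literal (e , par ψ qf) = dnf-literal (e , par (~ ψ) (~ qf))

    -- The De Morgan law that is not constructive in general; it holds here because `Sat?` decides
    -- the first literal.
    dnf-¬Conj : ∀ c → DNF (λ x ρ → ¬ Conj c x ρ)
    dnf-¬Conj []      = dnf-⊥ λ x ρ ¬[] → ¬[] []
    dnf-¬Conj (l ∷ c) = dnf-resp
      (λ x ρ → mk⇔ (from′ x ρ) (λ { (inj₁ ¬s) (s ∷ _) → ¬s s ; (inj₂ ¬ss) (_ ∷ ss) → ¬ss ss }))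
      (dnf-∨ (dnf-¬literal l) (dnf-¬Conj c))
      where
      from′ : ∀ x ρ → ¬ Conj (l ∷ c) x ρ → ¬ XSat x ρ l ⊎ ¬ Conj c x ρ
      from′ x ρ ¬c with Sat? (x ^ suc (proj₁ l)) ρ (proj₂ l)
      ... | yes s = inj₂ λ ss → ¬c (s ∷ ss)
      ... | no ¬s = inj₁ ¬s

    dnf-¬Disj : ∀ D → DNF (λ x ρ → ¬ Disj D x ρ)
    dnf-¬Disj []      = dnf-⊤ λ x ρ ()
    dnf-¬Disj (c ∷ D) = dnf-resp
      (λ x ρ → mk⇔ (λ ¬d → (λ s → ¬d (here s)) , (λ d → ¬d (there d)))
                   (λ { (¬s , _) (here s) → ¬s s ; (_ , ¬d) (there d) → ¬d d }))
      (dnf-∧ (dnf-¬Conj c) (dnf-¬Disj D))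

    dnf-¬ : {P : Carrier → Vec Carrier n → Set} → DNF P → DNF (λ x ρ → ¬ P x ρ)
    dnf-¬ (D , P⇔D) = dnf-resp (λ x ρ → ¬-cong-⇔ (P⇔D x ρ)) (dnf-¬Disj D)

  -- Atomic formulas in x

  -- Expresses t = x^(a-b) u without negative exponents.
  record Separated {n} (t : Term (suc n)) : Set where
    constructor separated
    field
      a b   : ℕ
      u     : Term n
      ⟪⟫-≡  : ∀ x ρ → ⟪ t ⟫ (x ∷ ρ) ∙ x ^ b ≡ x ^ a ∙ ⟪ u ⟫ ρ

  separate : ∀ {n} (t : Term (suc n)) → Separated t
  separate (var zero)    = separated 1 0 𝟏 λ x ρ → solve (x ∷ []) (X · 𝟏) (X · 𝟏 · 𝟏) refl
  separate (var (suc i)) = separated 0 0 (var i) λ x ρ → comm _ _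
  separate 𝟏             = separated 0 0 𝟏 λ x ρ → refl
  separate (s · t) with separate s | separate t
  ... | separated a b u s≡ | separated c d v t≡ = separated (a + c) (b + d) (u · v) λ x ρ → begin
    ⟪ s ⟫ (x ∷ ρ) ∙ ⟪ t ⟫ (x ∷ ρ) ∙ x ^ (b + d)          ≡⟨ cong (_ ∙_) (^-+ x b d) ⟩
    ⟪ s ⟫ (x ∷ ρ) ∙ ⟪ t ⟫ (x ∷ ρ) ∙ (x ^ b ∙ x ^ d)      ≡⟨ interchange _ _ _ _ ⟩
    ⟪ s ⟫ (x ∷ ρ) ∙ x ^ b ∙ (⟪ t ⟫ (x ∷ ρ) ∙ x ^ d)      ≡⟨ cong₂ _∙_ (s≡ x ρ) (t≡ x ρ) ⟩
    x ^ a ∙ ⟪ u ⟫ ρ ∙ (x ^ c ∙ ⟪ v ⟫ ρ)                  ≡⟨ interchange _ _ _ _ ⟩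
    x ^ a ∙ x ^ c ∙ (⟪ u ⟫ ρ ∙ ⟪ v ⟫ ρ)                  ≡⟨ cong (_∙ _) (^-+ x a c) ⟨
    x ^ (a + c) ∙ (⟪ u ⟫ ρ ∙ ⟪ v ⟫ ρ)                    ∎
    where open ≡-Reasoning
  separate (t ⁻¹) with separate t
  ... | separated a b u t≡ = separated b a (u ⁻¹) λ x ρ → begin
    ⟪ t ⟫ (x ∷ ρ) ⁻ ∙ x ^ a
      ≡⟨ solve (⟪ t ⟫ (x ∷ ρ) ∷ x ^ a ∷ ⟪ u ⟫ ρ ∷ []) (X ⁻¹ · Y) (X ⁻¹ · (Y · Z) · Z ⁻¹) refl ⟩
    ⟪ t ⟫ (x ∷ ρ) ⁻ ∙ (x ^ a ∙ ⟪ u ⟫ ρ) ∙ ⟪ u ⟫ ρ ⁻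
      ≡⟨ cong (λ z → ⟪ t ⟫ (x ∷ ρ) ⁻ ∙ z ∙ ⟪ u ⟫ ρ ⁻) (t≡ x ρ) ⟨
    ⟪ t ⟫ (x ∷ ρ) ⁻ ∙ (⟪ t ⟫ (x ∷ ρ) ∙ x ^ b) ∙ ⟪ u ⟫ ρ ⁻
      ≡⟨ solve (⟪ t ⟫ (x ∷ ρ) ∷ x ^ b ∷ ⟪ u ⟫ ρ ∷ []) (X ⁻¹ · (X · Y) · Z ⁻¹) (Y · Z ⁻¹) refl ⟩
    x ^ b ∙ ⟪ u ⟫ ρ ⁻  ∎
    where open ≡-Reasoning

  ^-raise : ∀ x a k v → x ^ suc k ∙ (x ^ a ∙ v) ≡ x ^ suc (a + k) ∙ v
  ^-raise x a k v = trans (sym (assoc _ _ _)) (cong (_∙ v)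
    (trans (sym (^-+ x (suc k) a)) (cong (λ i → x ^ suc i) (ℕ.+-comm k a))))

  -- Cancelling the smaller power of x and the parameter beside the larger one isolates a positive
  -- power of x; for equal exponents x disappears.
  dnf-monomial-⊏ : ∀ {n} a b (u v : Term n) → DNF (λ x ρ → x ^ a ∙ ⟪ u ⟫ ρ ⊏ x ^ b ∙ ⟪ v ⟫ ρ)
  dnf-monomial-⊏ a b u v with ℕ.compare a b
  ... | ℕ.equal _ = dnf-resp
    (λ x ρ → ⇔.sym (⊏-scale (x ^ a) (comm _ _) (comm _ _)))
    -- The exponent 0 is a dummy, as `par` does not depend on y.
    (dnf-literal (0 , par (u ≺ v) (u ≺ v)))
  ... | ℕ.less _ k = dnf-resp
    (λ x ρ → ⇔.sym (⊏-scale (x ^ a ∙ ⟪ v ⟫ ρ)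
      (solve (⟪ u ⟫ ρ ∷ ⟪ v ⟫ ρ ∷ x ^ a ∷ []) (X · Y ⁻¹ · (Z · Y)) (Z · X) refl)
      (^-raise x a k (⟪ v ⟫ ρ))))
    (dnf-literal (k , gt (u · v ⁻¹)))
  ... | ℕ.greater _ k = dnf-resp
    (λ x ρ → ⇔.sym (⊏-scale (x ^ b ∙ ⟪ u ⟫ ρ)
      (^-raise x b k (⟪ u ⟫ ρ))
      (solve (⟪ v ⟫ ρ ∷ ⟪ u ⟫ ρ ∷ x ^ b ∷ []) (X · Y ⁻¹ · (Z · Y)) (Z · X) refl)))
    (dnf-literal (k , lt (v · u ⁻¹)))

  dnf-≺ : ∀ {n} (s t : Term (suc n)) → DNF (λ x ρ → ⟪ s ⟫ (x ∷ ρ) ⊏ ⟪ t ⟫ (x ∷ ρ))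
  dnf-≺ s t with separate s | separate t
  ... | separated a b u s≡ | separated c d v t≡ = dnf-resp
    (λ x ρ → ⊏-scale (x ^ b ∙ x ^ d) (left x ρ) (right x ρ))
    (dnf-monomial-⊏ (a + d) (c + b) u v)
    where
    open ≡-Reasoning
    left : ∀ x ρ → ⟪ s ⟫ (x ∷ ρ) ∙ (x ^ b ∙ x ^ d) ≡ x ^ (a + d) ∙ ⟪ u ⟫ ρ
    left x ρ = begin
      ⟪ s ⟫ (x ∷ ρ) ∙ (x ^ b ∙ x ^ d)   ≡⟨ assoc _ _ _ ⟨
      ⟪ s ⟫ (x ∷ ρ) ∙ x ^ b ∙ x ^ d     ≡⟨ cong (_∙ x ^ d) (s≡ x ρ) ⟩
      x ^ a ∙ ⟪ u ⟫ ρ ∙ x ^ d           ≡⟨ xy∙z≈xz∙y _ _ _ ⟩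
      x ^ a ∙ x ^ d ∙ ⟪ u ⟫ ρ           ≡⟨ cong (_∙ ⟪ u ⟫ ρ) (^-+ x a d) ⟨
      x ^ (a + d) ∙ ⟪ u ⟫ ρ             ∎
    right : ∀ x ρ → ⟪ t ⟫ (x ∷ ρ) ∙ (x ^ b ∙ x ^ d) ≡ x ^ (c + b) ∙ ⟪ v ⟫ ρ
    right x ρ = begin
      ⟪ t ⟫ (x ∷ ρ) ∙ (x ^ b ∙ x ^ d)   ≡⟨ solve (⟪ t ⟫ (x ∷ ρ) ∷ x ^ b ∷ x ^ d ∷ []) (X · (Y · Z)) (X · Z · Y) refl ⟩
      ⟪ t ⟫ (x ∷ ρ) ∙ x ^ d ∙ x ^ b     ≡⟨ cong (_∙ x ^ b) (t≡ x ρ) ⟩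
      x ^ c ∙ ⟪ v ⟫ ρ ∙ x ^ b           ≡⟨ xy∙z≈xz∙y _ _ _ ⟩
      x ^ c ∙ x ^ b ∙ ⟪ v ⟫ ρ           ≡⟨ cong (_∙ ⟪ v ⟫ ρ) (^-+ x c b) ⟨
      x ^ (c + b) ∙ ⟪ v ⟫ ρ             ∎

  -- By trichotomy an equation is a pair of negated inequalities, so exponents of x are compared for
  -- `≺` only; literals `eq` reappear when these are negated.
  dnf-≐ : ∀ {n} (s t : Term (suc n)) → DNF (λ x ρ → ⟪ s ⟫ (x ∷ ρ) ≡ ⟪ t ⟫ (x ∷ ρ))
  dnf-≐ s t = dnf-resp
    (λ x ρ → mk⇔ (λ s≡t → (λ s⊏t → ⊏-irrefl (subst (_⊏ _) s≡t s⊏t)) ,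
                         (λ t⊏s → ⊏-irrefl (subst (_ ⊏_) s≡t t⊏s)))
                 (λ (t⊑s , s⊑t) → [ id , (λ t⊏s → contradiction t⊏s s⊑t) ]′ (to ⊏̸-⇔ t⊑s)))
    (dnf-∧ (dnf-¬ (dnf-≺ s t)) (dnf-¬ (dnf-≺ t s)))

  -- With t xᵇ = xᵃ u, multiply t by the power (x¹⁺ᵇ)¹⁺ᵏ: this makes the exponent of x positive.
  dnf-pow : ∀ {n} k (t : Term (suc n)) → DNF (λ x ρ → IsPow (suc k) (⟪ t ⟫ (x ∷ ρ)))
  dnf-pow k t with separate t
  ... | separated a b u t≡ = dnf-resp
    (λ x ρ → IsPow-shift (suc k) (IsPow-^ (suc k) (x ^ suc b)) (shifted x ρ))
    (dnf-literal (k + (a + b * k) , pow k u))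
    where
    open ≡-Reasoning
    lemma₁ : ∀ k b → suc k * suc b ≡ b + (suc k + b * k)
    lemma₁ = solve-∀
    lemma₂ : ∀ a k b → a + (suc k + b * k) ≡ suc (k + (a + b * k))
    lemma₂ = solve-∀
    shifted : ∀ x ρ → ⟪ t ⟫ (x ∷ ρ) ∙ x ^ suc b ^ suc k ≡ x ^ suc (k + (a + b * k)) ∙ ⟪ u ⟫ ρ
    shifted x ρ = begin
      ⟪ t ⟫ (x ∷ ρ) ∙ x ^ suc b ^ suc k        ≡⟨ cong (⟪ t ⟫ (x ∷ ρ) ∙_) (^-^ x (suc b) (suc k)) ⟩
      ⟪ t ⟫ (x ∷ ρ) ∙ x ^ (suc k * suc b)      ≡⟨ cong (λ i → ⟪ t ⟫ (x ∷ ρ) ∙ x ^ i) (lemma₁ k b) ⟩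
      ⟪ t ⟫ (x ∷ ρ) ∙ x ^ (b + e)              ≡⟨ cong (_ ∙_) (^-+ x b e) ⟩
      ⟪ t ⟫ (x ∷ ρ) ∙ (x ^ b ∙ x ^ e)          ≡⟨ assoc _ _ _ ⟨
      ⟪ t ⟫ (x ∷ ρ) ∙ x ^ b ∙ x ^ e            ≡⟨ cong (_∙ x ^ e) (t≡ x ρ) ⟩
      x ^ a ∙ ⟪ u ⟫ ρ ∙ x ^ e                  ≡⟨ xy∙z≈xz∙y _ _ _ ⟩
      x ^ a ∙ x ^ e ∙ ⟪ u ⟫ ρ                  ≡⟨ cong (_∙ ⟪ u ⟫ ρ) (^-+ x a e) ⟨
      x ^ (a + e) ∙ ⟪ u ⟫ ρ                    ≡⟨ cong (λ i → x ^ i ∙ ⟪ u ⟫ ρ) (lemma₂ a k b) ⟩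
      x ^ suc (k + (a + b * k)) ∙ ⟪ u ⟫ ρ      ∎
      where e = suc k + b * k

  dnf-quantifierFree : ∀ {n} {φ : Formula (suc n)} → QuantifierFree φ → DNF (λ x ρ → x ∷ ρ ⊩ φ)
  dnf-quantifierFree (s ≐ t)       = dnf-≐ s t
  dnf-quantifierFree (s ≺ t)       = dnf-≺ s t
  dnf-quantifierFree (R (suc k) t) = dnf-pow k t
  dnf-quantifierFree (~ p)         = dnf-¬ (dnf-quantifierFree p)
  dnf-quantifierFree (p ∧ q)       = dnf-∧ (dnf-quantifierFree p) (dnf-quantifierFree q)
  dnf-quantifierFree (p ∨ q)       = dnf-∨ (dnf-quantifierFree p) (dnf-quantifierFree q)
  dnf-quantifierFree (p ⇒ q)       = dnf-resp
    (λ x ρ → mk⇔ (implies (quantifierFree? p (x ∷ ρ)))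
                 (λ { (inj₁ ¬φ) φ → contradiction φ ¬φ ; (inj₂ ψ) _ → ψ }))
    (dnf-∨ (dnf-¬ (dnf-quantifierFree p)) (dnf-quantifierFree q))
    where
    implies : {A B : Set} → Dec A → (A → B) → ¬ A ⊎ B
    implies (yes a) f = inj₂ (f a)
    implies (no ¬a) f = inj₁ ¬a

  quantifierElimination : ∀ {n} (φ : Formula n) → Definable (_⊩ φ)
  quantifierElimination (s ≐ t)       = definable-≐ s t
  quantifierElimination (s ≺ t)       = definable-≺ s t
  quantifierElimination (R (suc k) t) = definable-pow k t
  quantifierElimination (~ φ)         = definable-¬ (quantifierElimination φ)
  quantifierElimination (φ ∧ ψ)       = definable-∧ (quantifierElimination φ) (quantifierElimination ψ)
  quantifierElimination (φ ∨ ψ)       = definable-∨ (quantifierElimination φ) (quantifierElimination ψ)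
  quantifierElimination (φ ⇒ ψ)       = definable-⇒ (quantifierElimination φ) (quantifierElimination ψ)
  -- Treated as ¬ ∃ ¬; the way back is double negation elimination for the decidable ψ.
  quantifierElimination (all φ) with quantifierElimination φ
  ... | ψ , qf , φ⇔ψ = definable-resp
    (λ ρ → mk⇔ (λ f (x , ¬ψ) → ¬ψ (to (φ⇔ψ (x ∷ ρ)) (f x)))
               (λ ¬∃ x → from (φ⇔ψ (x ∷ ρ))
                 (Dec.decidable-stable (quantifierFree? qf (x ∷ ρ)) λ ¬ψ → ¬∃ (x , ¬ψ))))
    (definable-¬ (definable-∃ (dnf-¬ (dnf-quantifierFree qf))))
  quantifierElimination (ex φ) with quantifierElimination φ
  ... | ψ , qf , φ⇔ψ = definable-resp
    (λ ρ → mk⇔ (λ (x , p) → x , to (φ⇔ψ (x ∷ ρ)) p) (λ (x , q) → x , from (φ⇔ψ (x ∷ ρ)) q))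
    (definable-∃ (dnf-quantifierFree qf))

-- The positive rationals

value-injective : ∀ {x y} → value x ≡ value y → x ≡ y
value-injective refl = refl

ℚ⁺-isAbelianGroup : IsAbelianGroup _≡_ _*⁺_ 1⁺ _⁻¹⁺
ℚ⁺-isAbelianGroup = record
  { isGroup = record
    { isMonoid = record
      { isSemigroup = record
        { isMagma = record { isEquivalence = isEquivalence ; ∙-cong = cong₂ _*⁺_ }
        ; assoc   = λ x y z → value-injective (ℚ.*-assoc (value x) (value y) (value z))
        }
      ; identity = (λ x → value-injective (ℚ.*-identityˡ (value x)))
                 , (λ x → value-injective (ℚ.*-identityʳ (value x)))
      }
    ; inverse = (λ (mkℚ⁺ p) → value-injective (ℚ.*-inverseˡ p {{ℚ.pos⇒nonZero p}}))
              , (λ (mkℚ⁺ p) → value-injective (ℚ.*-inverseʳ p {{ℚ.pos⇒nonZero p}}))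
    ; ⁻¹-cong = cong _⁻¹⁺
    }
  ; comm = λ x y → value-injective (ℚ.*-comm (value x) (value y))
  }

<⁺-compare : Trichotomous _≡_ _<⁺_
<⁺-compare x y with ℚ.<-cmp (value x) (value y)
... | tri< x<y x≢y x≯y = tri< x<y (x≢y ∘ cong value) x≯y
... | tri≈ x≮y x≡y x≯y = tri≈ x≮y (value-injective x≡y) x≯y
... | tri> x≮y x≢y x>y = tri> x≮y (x≢y ∘ cong value) x>y

fromℕ⁺ : (a : ℕ) .{{_ : NonZero a}} → ℚ⁺
fromℕ⁺ a = mkℚ⁺ (mkℚ+ a 1 a⊥1) {{ℚ.mkℚ+-pos a 1 {a⊥1}}}
  where
  a⊥1 : Coprime a 1
  a⊥1 = coprime-sym (1-coprimeTo a)

fromℕ⁺-* : ∀ a b .{{_ : NonZero a}} .{{_ : NonZero b}} →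
           fromℕ⁺ (a * b) {{ℕ.m*n≢0 a b}} ≡ fromℕ⁺ a *⁺ fromℕ⁺ b
fromℕ⁺-* a b = value-injective (ℚ.toℚᵘ-injective (ℚᵘ.≃-trans
  (ℚᵘ.*≡* (cong (ℤ._* ℤ.+ 1) (ℤ.pos-* a b)))
  (ℚᵘ.≃-sym (ℚ.toℚᵘ-homo-* (value (fromℕ⁺ a)) (value (fromℕ⁺ b))))))

fromℕ⁺-mono-< : ∀ {a b} .{{_ : NonZero a}} .{{_ : NonZero b}} → a < b → fromℕ⁺ a <⁺ fromℕ⁺ b
fromℕ⁺-mono-< {a} {b} a<b = *<* (ℤ.*-monoʳ-<-pos (ℤ.+ 1) {ℤ.+ a} {ℤ.+ b} (+<+ a<b))

fromℕ⁺-fraction : ∀ x → ∃[ a ] ∃[ b ] ∃[ a≢0 ] ∃[ b≢0 ] x *⁺ fromℕ⁺ b {{b≢0}} ≡ fromℕ⁺ a {{a≢0}}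
fromℕ⁺-fraction (mkℚ⁺ p@(mkℚ +[1+ n ] d _)) = suc n , suc d , _ , _ ,
  value-injective (ℚ.toℚᵘ-injective (ℚᵘ.≃-trans
    (ℚ.toℚᵘ-homo-* p (value (fromℕ⁺ (suc d))))
    (ℚᵘ.*≡* (trans (ℤ.*-assoc +[1+ n ] (ℤ.+ suc d) (ℤ.+ 1)) (cong (+[1+ n ] ℤ.*_) (sym (ℤ.pos-* (suc d) 1)))))))

ℚ⁺-positiveFractions : PositiveFractions
ℚ⁺-positiveFractions = record
  { isAbelianGroup = ℚ⁺-isAbelianGroup
  ; compare        = <⁺-compare
  ; ⊏-trans        = ℚ.<-trans
  ; ∙-monoˡ-⊏      = λ (mkℚ⁺ r) → ℚ.*-monoˡ-<-pos r
  ; ι              = fromℕ⁺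
  ; ι-*            = fromℕ⁺-*
  ; ι-mono-⊏       = fromℕ⁺-mono-<
  ; fraction       = fromℕ⁺-fraction
  }

open FractionGroup ℚ⁺-positiveFractions using (⟪_⟫; _^_; IsPow; root)
open Elimination ℚ⁺-positiveFractions using (_⊩_; quantifierElimination)

⟦⟧≡⟪⟫ : ∀ {n} (t : Term n) as → ⟦ t ⟧ as ≡ ⟪ t ⟫ as
⟦⟧≡⟪⟫ (var i) as = refl
⟦⟧≡⟪⟫ 𝟏       as = refl
⟦⟧≡⟪⟫ (s · t) as = cong₂ _*⁺_ (⟦⟧≡⟪⟫ s as) (⟦⟧≡⟪⟫ t as)
⟦⟧≡⟪⟫ (t ⁻¹)  as = cong _⁻¹⁺ (⟦⟧≡⟪⟫ t as)

-- The right-hand side is what the power in `IsPower` unfolds to.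
value-^ : ∀ y k → value (y ^ k) ≡ mult ℚ.*-1-rawMonoid k (value y)
value-^ y zero    = refl
value-^ y (suc k) = cong (value y ℚ.*_) (value-^ y k)

isPower-⇔ : ∀ k x → IsPower k x ⇔ IsPow k x
isPower-⇔ k x = mk⇔
  (λ (y , eq) → root y (value-injective (trans eq (sym (value-^ y k)))))
  (λ (root y eq) → y , trans (cong value eq) (value-^ y k))

⊨⇔⊩ : ∀ {n} (φ : Formula n) as → (as ⊨ φ) ⇔ (as ⊩ φ)
⊨⇔⊩ (s ≐ t) as rewrite ⟦⟧≡⟪⟫ s as | ⟦⟧≡⟪⟫ t as = ⇔-id _
⊨⇔⊩ (s ≺ t) as rewrite ⟦⟧≡⟪⟫ s as | ⟦⟧≡⟪⟫ t as = ⇔-id _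
⊨⇔⊩ (R k t) as rewrite ⟦⟧≡⟪⟫ t as = isPower-⇔ k (⟪ t ⟫ as)
⊨⇔⊩ (~ φ)   as = ¬-cong-⇔ (⊨⇔⊩ φ as)
⊨⇔⊩ (φ ∧ ψ) as = ⊨⇔⊩ φ as ×-⇔ ⊨⇔⊩ ψ as
⊨⇔⊩ (φ ∨ ψ) as = ⊨⇔⊩ φ as ⊎-⇔ ⊨⇔⊩ ψ as
⊨⇔⊩ (φ ⇒ ψ) as = →-cong-⇔ (⊨⇔⊩ φ as) (⊨⇔⊩ ψ as)
⊨⇔⊩ (all φ) as = mk⇔ (λ f a → Equivalence.to (⊨⇔⊩ φ (a ∷ as)) (f a))
                     (λ f a → Equivalence.from (⊨⇔⊩ φ (a ∷ as)) (f a))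
⊨⇔⊩ (ex φ)  as = mk⇔ (λ (a , p) → a , Equivalence.to (⊨⇔⊩ φ (a ∷ as)) p)
                     (λ (a , p) → a , Equivalence.from (⊨⇔⊩ φ (a ∷ as)) p)

mainTheorem3 : ∀ (n : ℕ) (φ : Formula n) →
    ∃[ ψ ] (QuantifierFree ψ × (∀ (as : Vec ℚ⁺ n) → (as ⊨ φ) ⇔ (as ⊨ ψ)))
mainTheorem3 n φ with quantifierElimination φ
... | ψ , qf , φ⇔ψ = ψ , qf , λ as → ⇔.trans (⊨⇔⊩ φ as) (⇔.trans (φ⇔ψ as) (⇔.sym (⊨⇔⊩ ψ as)))
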